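{- Fix $n,m\in\mathbb{Z}_{\ge0}$ and $\alpha>0$. For every Schur-concave objective $f:\mathbb{Z}_{\ge0}^n\to\mathbb{R}_{\ge0}$ and every (possibly randomized) allocation strategy $\mathcal{A}'$, $$\mathrm{Reg}^{n,m}_{f,\alpha}(\mathrm{BL})\le \mathrm{Reg}^{n,m}_{f,\alpha}(\mathcal{A}').$$ Likewise, for every Schur-convex objective $g:\mathbb{Z}_{\ge0}^n\to\mathbb{R}_{\ge0}$ and every allocation strategy $\mathcal{A}'$, $$\mathrm{Reg}^{n,m}_{g,\alpha}(\mathrm{BL})\le \mathrm{Reg}^{n,m}_{g,\alpha}(\mathcal{A}').$$ Here $f$ is an objective to be maximized and $g$ is an objective to be minimized, with the corresponding definitions of regret.
   Context: **Notation.** $[n]=\{1,\dots,n\}$; for a vector $\mathbf{x}$ indexed by $[n]$ and $A\subseteq[n]$, $\mathbf{x}(A)=\sum_{i\in A}\mathbf{x}(i)$. **Discrete polymatroids.** A rank function is $r:2^{[n]}\to\mathbb{Z}_{\ge 0}$ that is normalized ($r(\emptyset)=0$), monotone ($r(A)\le r(B)$ for $A\subseteq B$) and submodular ($r(A)+r(B)\ge r(A\cap B)+r(A\cup B)$). It defines the discrete polymatroid $P=\{\mathbf{x}\in\mathbb{Z}_{\ge0}^n : \mathbf{x}(A)\le r(A)\ \forall A\subseteq[n]\}$, with $\mathrm{Rank}(P)=r([n])$ and $\mathrm{Bases}(P)=\{\mathbf{x}\in P:\mathbf{x}([n])=r([n])\}$. **Game.** On round $t=1,2,\dots$ the adversary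 presents a discrete polymatroid $P_t$ on $[n]$; the algorithm designer then irrevocably selects a basis $\mathbf{x}_t\in\mathrm{Bases}(P_t)$. The game ends after a finite number $h$ of rounds, when $\sum_{t=1}^h \mathrm{Rank}(P_t)=m$ exactly. An adversarial strategy $\mathcal{P}$ deterministically maps the history of play (all previous polymatroids and selected bases) to the next polymatroid; $\mathcal{P}_{n,m}$ is the set of adversarial strategies for $n$ agents and $m$ resources (against every designer strategy, the total rank presented is exactly $m$). An allocation strategy $\mathcal{A}$ maps, possibly at random, a history of play and the currently presented polymatroid to a basis of that polymatroid. The profile $(\mathcal{A},\mathcal{P})$ induces a (possibly random) sequence of polymatroids $(P_t)_{t\in[h]}$ and bases $(\mathbf{x}_t)_{t\in[h]}$; set $\boldsymbol{\ell}(\mathcal{A},\mathcal{P})=\sum_{t\in[h]}\mathbf{x}_t$ (the load vector) and $H(\mathcal{A},\mathcal{P})=\{\sum_{t\in[h]}\mathbf{z}_t:\mathbf{z}_t\in\mathrm{Bases}(P_t)\}$. **Majorization.** For $\mathbf{x},\mathbf{y}\in\mathbb{Z}_{\ge0}^n$ with $\mathbf{x}([n])=\mathbf{y}([n])$, write $\mathbf{x}\succeq\mathbf{y}$ (equivalently $\mathbf{y}\preceq\mathbf{x}$) when $\mathbf{x}^{\uparrow}([k])\le\mathbf{y}^{\uparrow}([k])$ for all $k\in[n]$, where $\mathbf{x}^\uparrow(i)$ is the $i$-th smallest entry of $\mathbf{x}$. A function $f$ is Schur-concave if $\mathbf{x}\preceq\mathbf{y}$ implies $f(\mathbf{x})\ge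 f(\mathbf{y})$; $g$ is Schur-convex if $\mathbf{x}\preceq\mathbf{y}$ implies $g(\mathbf{x})\le g(\mathbf{y})$. **Cost and regret.** For $f$ to be maximized, $c_{f,\alpha}(\mathcal{A},\mathcal{P})=\mathbb{E}_{\mathcal{A}}\big[\alpha\cdot\sup_{\boldsymbol{\ell}^*\in H(\mathcal{A},\mathcal{P})}f(\boldsymbol{\ell}^*)-f(\boldsymbol{\ell}(\mathcal{A},\mathcal{P}))\big]$. For $g$ to be minimized, $c_{g,\alpha}(\mathcal{A},\mathcal{P})=\mathbb{E}_{\mathcal{A}}\big[g(\boldsymbol{\ell}(\mathcal{A},\mathcal{P}))-\alpha\cdot\inf_{\boldsymbol{\ell}^*\in H(\mathcal{A},\mathcal{P})}g(\boldsymbol{\ell}^*)\big]$. In both cases the $\alpha$-regret is the supremum of the cost over adversaries: $\mathrm{Reg}^{n,m}_{f,\alpha}(\mathcal{A})=\sup_{\mathcal{P}\in\mathcal{P}_{n,m}}c_{f,\alpha}(\mathcal{A},\mathcal{P})$ and $\mathrm{Reg}^{n,m}_{g,\alpha}(\mathcal{A})=\sup_{\mathcal{P}\in\mathcal{P}_{n,m}}c_{g,\alpha}(\mathcal{A},\mathcal{P})$. **Brick-Laying.** $\mathrm{BL}$ is the deterministic strategy which, on round $t$ with current load $\boldsymbol{\ell}_{t-1}=\sum_{s<t}\mathbf{x}_s$, selects any $\mathbf{x}_t\in\mathrm{Bases}(P_t)$ with $\boldsymbol{\ell}_{t-1}+\mathbf{x}_t\preceq\boldsymbol{\ell}_{t-1}+\mathbf{x}$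 for all $\mathbf{x}\in\mathrm{Bases}(P_t)$ (such a basis always exists; ties are broken by an arbitrary deterministic rule). -}

module Defs where

open import Data.Bool.Base using (if_then_else_)
open import Data.Fin.Subset using (Subset; ⊤; ⊥; _∩_; _∪_; _⊆_)
open import Data.Fin.Subset.Properties using (anySubset?)
open import Data.List.Base using (List; []; _∷_; foldr; map; filter; take; upTo; cartesianProductWith)
open import Data.List.Membership.Propositional using (_∈_)
open import Data.List.Membership.Propositional.Properties
  using (∈-filter⁺; ∈-filter⁻; ∈-cartesianProductWith⁺; ∈-upTo⁺)
open import Data.List.Relation.Unary.All using (All; []; _∷_)
open import Data.List.Relation.Unary.Any using (here; there)
open import Data.List.Sort using (sort)
open import Data.Nat.Base as ℕ using (ℕ; zero; suc)
open import Data.Nat.ListAction using (sum)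
import Data.Nat.Properties as ℕ
open import Data.Product.Base using (Σ; _×_; _,_; proj₁; proj₂; ∃)
open import Data.Rational.Base as ℚ using (ℚ; 0ℚ; 1ℚ; ½)
import Data.Rational.Properties as ℚ
open import Data.Rational.Solver using (module +-*-Solver)
open import Data.Sum.Base using (inj₁; inj₂)
open import Data.Vec.Base as Vec using (Vec; []; _∷_; zipWith; replicate; toList)
open import Function.Base using (_∘_)
open import Function.Bundles using (_⇔_; mk⇔)
open import Relation.Binary.PropositionalEquality
  using (_≡_; _≢_; refl; sym; trans; cong; cong₂; subst)
open import Relation.Nullary.Decidable using (Dec; _×-dec_; ¬?; recompute; decidable-stable)
import Relation.Nullary.Decidable as Dec

-- Reals are compared by _≈ᴿ_ and never by _≡_.

IsCauchy : (ℕ → ℚ) → Set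
IsCauchy x = ∀ ε → 0ℚ ℚ.< ε →
  ∃ λ N → ∀ m n → N ℕ.≤ m → N ℕ.≤ n → ℚ.∣ x m ℚ.- x n ∣ ℚ.≤ ε

record ℝ : Set where
  constructor mkℝ
  field
    seq    : ℕ → ℚ
    cauchy : IsCauchy seq

open ℝ public

infix  4 _≤ᴿ_ _<ᴿ_ _≈ᴿ_
infixl 6 _+ᴿ_ _-ᴿ_ _⊔ᴿ_ _⊓ᴿ_
infixl 7 _*ᴿ_
infix  8 -ᴿ_

record _≤ᴿ_ (x y : ℝ) : Set where
  constructor mk≤
  field
    within : ∀ ε → 0ℚ ℚ.< ε → ∃ λ N → ∀ n → N ℕ.≤ n → seq x n ℚ.≤ seq y n ℚ.+ ε

open _≤ᴿ_ public

_<ᴿ_ : ℝ → ℝ → Set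
x <ᴿ y = ∃ λ ε → 0ℚ ℚ.< ε × ∃ λ N → ∀ n → N ℕ.≤ n → seq x n ℚ.+ ε ℚ.≤ seq y n

_≈ᴿ_ : ℝ → ℝ → Set
x ≈ᴿ y = x ≤ᴿ y × y ≤ᴿ x

private
  module _ where
    open +-*-Solver

    neg-flip : ∀ p q → ℚ.- (p ℚ.- q) ≡ q ℚ.- p
    neg-flip = solve 2 (λ p q → :- (p :+ :- q) := q :+ :- p) refl

    add-sub : ∀ q p → q ℚ.+ (p ℚ.- q) ≡ p
    add-sub = solve 2 (λ q p → q :+ (p :+ :- q) := p) refl

    sub-add : ∀ q ε → (q ℚ.+ ε) ℚ.- q ≡ ε
    sub-add = solve 2 (λ q ε → (q :+ ε) :+ :- q := ε) refl

    +-regroup : ∀ a b c d → (a ℚ.+ b) ℚ.- (c ℚ.+ d) ≡ (a ℚ.- c) ℚ.+ (b ℚ.- d)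
    +-regroup = solve 4 (λ a b c d →
      (a :+ b) :+ :- (c :+ d) := (a :+ :- c) :+ (b :+ :- d)) refl

    neg-regroup : ∀ a b → (ℚ.- a) ℚ.- (ℚ.- b) ≡ b ℚ.- a
    neg-regroup = solve 2 (λ a b → (:- a) :+ :- (:- b) := b :+ :- a) refl

    *-regroup : ∀ a b c d → a ℚ.* b ℚ.- c ℚ.* d ≡ a ℚ.* (b ℚ.- d) ℚ.+ (a ℚ.- c) ℚ.* d
    *-regroup = solve 4 (λ a b c d →
      a :* b :+ :- (c :* d) := a :* (b :+ :- d) :+ (a :+ :- c) :* d) refl

    *-collect : ∀ b c e i → b ℚ.* (e ℚ.* i) ℚ.+ (e ℚ.* i) ℚ.* c ≡ e ℚ.* (i ℚ.* (b ℚ.+ c))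
    *-collect = solve 4 (λ b c e i →
      b :* (e :* i) :+ (e :* i) :* c := e :* (i :* (b :+ c))) refl

  half-pos : ∀ {ε} → 0ℚ ℚ.< ε → 0ℚ ℚ.< ε ℚ.* ½
  half-pos {ε} 0<ε = subst (ℚ._< ε ℚ.* ½) (ℚ.*-zeroˡ ½) (ℚ.*-monoˡ-<-pos ½ 0<ε)

  half-half : ∀ ε → ε ℚ.* ½ ℚ.+ ε ℚ.* ½ ≡ ε
  half-half ε = trans (sym (ℚ.*-distribˡ-+ ε ½ ½)) (ℚ.*-identityʳ ε)

  m⊔n≤o⇒ : ∀ m n {o} → m ℕ.⊔ n ℕ.≤ o → m ℕ.≤ o × n ℕ.≤ o
  m⊔n≤o⇒ m n le = ℕ.≤-trans (ℕ.m≤m⊔n m n) le , ℕ.≤-trans (ℕ.m≤n⊔m m n) le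

  p≤∣p∣ : ∀ p → p ℚ.≤ ℚ.∣ p ∣
  p≤∣p∣ p with ℚ.≤-total 0ℚ p
  ... | inj₁ 0≤p = ℚ.≤-reflexive (sym (ℚ.0≤p⇒∣p∣≡p 0≤p))
  ... | inj₂ p≤0 = ℚ.≤-trans p≤0 (ℚ.0≤∣p∣ p)

  ∣∣≤ : ∀ {p ε} → p ℚ.≤ ε → ℚ.- p ℚ.≤ ε → ℚ.∣ p ∣ ℚ.≤ ε
  ∣∣≤ {p} {ε} p≤ε -p≤ε with ℚ.∣p∣≡p∨∣p∣≡-p p
  ... | inj₁ eq = subst (ℚ._≤ ε) (sym eq) p≤ε
  ... | inj₂ eq = subst (ℚ._≤ ε) (sym eq) -p≤ε

  ∣p-q∣-sym : ∀ p q → ℚ.∣ p ℚ.- q ∣ ≡ ℚ.∣ q ℚ.- p ∣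
  ∣p-q∣-sym p q = trans (sym (ℚ.∣-p∣≡∣p∣ (p ℚ.- q)))
    (cong ℚ.∣_∣ (neg-flip p q))

  ∣-∣⇒≤ : ∀ {p q ε} → ℚ.∣ p ℚ.- q ∣ ℚ.≤ ε → p ℚ.≤ q ℚ.+ ε
  ∣-∣⇒≤ {p} {q} {ε} h = subst (ℚ._≤ q ℚ.+ ε)
    (add-sub q p)
    (ℚ.+-monoʳ-≤ q (ℚ.≤-trans (p≤∣p∣ (p ℚ.- q)) h))

  ≤⇒-≤ : ∀ {p q ε} → p ℚ.≤ q ℚ.+ ε → p ℚ.- q ℚ.≤ ε
  ≤⇒-≤ {p} {q} {ε} h = subst (p ℚ.- q ℚ.≤_)
    (sub-add q ε)
    (ℚ.+-monoˡ-≤ (ℚ.- q) h)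

  ≤⇒∣-∣ : ∀ {p q ε} → p ℚ.≤ q ℚ.+ ε → q ℚ.≤ p ℚ.+ ε → ℚ.∣ p ℚ.- q ∣ ℚ.≤ ε
  ≤⇒∣-∣ {p} {q} {ε} h k = ∣∣≤ (≤⇒-≤ h) (subst (ℚ._≤ ε)
    (sym (neg-flip p q)) (≤⇒-≤ k))

  p≤p+ε : ∀ {p ε} → 0ℚ ℚ.< ε → p ℚ.≤ p ℚ.+ ε
  p≤p+ε {p} {ε} 0<ε =
    subst (ℚ._≤ p ℚ.+ ε) (ℚ.+-identityʳ p) (ℚ.+-monoʳ-≤ p (ℚ.<⇒≤ 0<ε))

  *-mono-≤ : ∀ {p q r s} → 0ℚ ℚ.≤ r → 0ℚ ℚ.≤ q → p ℚ.≤ q → r ℚ.≤ s → p ℚ.* r ℚ.≤ q ℚ.* s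
  *-mono-≤ {p} {q} {r} 0≤r 0≤q p≤q r≤s = ℚ.≤-trans
    (ℚ.*-monoʳ-≤-nonNeg r {{ℚ.nonNegative 0≤r}} p≤q)
    (ℚ.*-monoˡ-≤-nonNeg q {{ℚ.nonNegative 0≤q}} r≤s)

  eventually-bounded : ∀ x → IsCauchy x →
    ∃ λ B → 0ℚ ℚ.< B × ∃ λ N → ∀ n → N ℕ.≤ n → ℚ.∣ x n ∣ ℚ.≤ B
  eventually-bounded x cx with cx 1ℚ (ℚ.positive⁻¹ 1ℚ)
  ... | N , close = ℚ.∣ x N ∣ ℚ.+ 1ℚ
    , ℚ.+-mono-≤-< (ℚ.0≤∣p∣ (x N)) (ℚ.positive⁻¹ 1ℚ)
    , N , λ n N≤n → ℚ.≤-trans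
        (ℚ.≤-reflexive (cong ℚ.∣_∣ (sym (add-sub (x N) (x n)))))
        (ℚ.≤-trans (ℚ.∣p+q∣≤∣p∣+∣q∣ (x N) (x n ℚ.- x N))
          (ℚ.+-monoʳ-≤ ℚ.∣ x N ∣ (close n N N≤n ℕ.≤-refl)))

  -- Abstract because comparing two reals up to conversion would otherwise
  -- unfold these proofs, at great cost.
  abstract
    const-cauchy : ∀ q → IsCauchy (λ _ → q)
    const-cauchy q ε 0<ε = 0 , λ _ _ _ _ →
      subst (λ d → ℚ.∣ d ∣ ℚ.≤ ε) (sym (ℚ.+-inverseʳ q)) (ℚ.<⇒≤ 0<ε)

    +-cauchy : ∀ x y → IsCauchy (λ n → seq x n ℚ.+ seq y n)
    +-cauchy (mkℝ x cx) (mkℝ y cy) ε 0<ε =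
      let (N , closeˣ) = cx (ε ℚ.* ½) (half-pos 0<ε)
          (M , closeʸ) = cy (ε ℚ.* ½) (half-pos 0<ε)
      in N ℕ.⊔ M , λ m n le le′ →
      let (N≤m , M≤m) = m⊔n≤o⇒ N M le
          (N≤n , M≤n) = m⊔n≤o⇒ N M le′
          a = x m ; b = y m ; c = x n ; d = y n
      in ℚ.≤-trans (ℚ.≤-reflexive (cong ℚ.∣_∣ (+-regroup a b c d)))
        (ℚ.≤-trans (ℚ.∣p+q∣≤∣p∣+∣q∣ (a ℚ.- c) (b ℚ.- d))
          (ℚ.≤-trans (ℚ.+-mono-≤ (closeˣ m n N≤m N≤n) (closeʸ m n M≤m M≤n))
            (ℚ.≤-reflexive (half-half ε))))

    neg-cauchy : ∀ x → IsCauchy (λ n → ℚ.- seq x n)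
    neg-cauchy (mkℝ x cx) ε 0<ε =
      let (N , close) = cx ε 0<ε
      in N , λ m n N≤m N≤n → ℚ.≤-trans
        (ℚ.≤-reflexive (cong ℚ.∣_∣ (neg-regroup (x m) (x n))))
        (close n m N≤n N≤m)

    *-cauchy : ∀ x y → IsCauchy (λ n → seq x n ℚ.* seq y n)
    *-cauchy (mkℝ x cx) (mkℝ y cy) ε 0<ε =
      let (B , 0<B , N₁ , x≤B) = eventually-bounded x cx
          (C , 0<C , N₂ , y≤C) = eventually-bounded y cy
          D = B ℚ.+ C
          instance
            D-pos : ℚ.Positive D
            D-pos = ℚ.positive (ℚ.+-mono-< 0<B 0<C)
            D-nonZero : ℚ.NonZero D
            D-nonZero = ℚ.pos⇒nonZero D
            1/D-pos : ℚ.Positive (ℚ.1/ D)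
            1/D-pos = ℚ.1/pos⇒pos D
          δ = ε ℚ.* ℚ.1/ D
          0<δ = subst (ℚ._< δ) (ℚ.*-zeroˡ (ℚ.1/ D)) (ℚ.*-monoˡ-<-pos (ℚ.1/ D) 0<ε)
          Bδ+δC≡ε : B ℚ.* δ ℚ.+ δ ℚ.* C ≡ ε
          Bδ+δC≡ε = trans (*-collect B C ε (ℚ.1/ D))
            (trans (cong (ε ℚ.*_) (ℚ.*-inverseˡ D)) (ℚ.*-identityʳ ε))
          (N₃ , closeˣ) = cx δ 0<δ
          (N₄ , closeʸ) = cy δ 0<δ
      in (N₁ ℕ.⊔ N₂) ℕ.⊔ (N₃ ℕ.⊔ N₄) , λ m n le le′ →
      let (le₁₂ , le₃₄) = m⊔n≤o⇒ (N₁ ℕ.⊔ N₂) (N₃ ℕ.⊔ N₄) le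
          (le₁₂′ , le₃₄′) = m⊔n≤o⇒ (N₁ ℕ.⊔ N₂) (N₃ ℕ.⊔ N₄) le′
          (N₁≤m , _) = m⊔n≤o⇒ N₁ N₂ le₁₂
          (_ , N₂≤n) = m⊔n≤o⇒ N₁ N₂ le₁₂′
          (N₃≤m , N₄≤m) = m⊔n≤o⇒ N₃ N₄ le₃₄
          (N₃≤n , N₄≤n) = m⊔n≤o⇒ N₃ N₄ le₃₄′
          a = x m ; b = y m ; c = x n ; d = y n
      in ℚ.≤-trans
        (ℚ.≤-reflexive (cong ℚ.∣_∣ (*-regroup a b c d)))
        (ℚ.≤-trans (ℚ.∣p+q∣≤∣p∣+∣q∣ (a ℚ.* (b ℚ.- d)) ((a ℚ.- c) ℚ.* d))
          (ℚ.≤-trans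
            (ℚ.≤-reflexive (cong₂ ℚ._+_ (ℚ.∣p*q∣≡∣p∣*∣q∣ a (b ℚ.- d)) (ℚ.∣p*q∣≡∣p∣*∣q∣ (a ℚ.- c) d)))
            (ℚ.≤-trans
              (ℚ.+-mono-≤
                (*-mono-≤ (ℚ.0≤∣p∣ (b ℚ.- d)) (ℚ.<⇒≤ 0<B) (x≤B m N₁≤m) (closeʸ m n N₄≤m N₄≤n))
                (*-mono-≤ (ℚ.0≤∣p∣ d) (ℚ.<⇒≤ 0<δ) (closeˣ m n N₃≤m N₃≤n) (y≤C n N₂≤n)))
              (ℚ.≤-reflexive Bδ+δC≡ε))))

  ⊔-close : ∀ {a b c d ε} → a ℚ.≤ c ℚ.+ ε → b ℚ.≤ d ℚ.+ ε → a ℚ.⊔ b ℚ.≤ c ℚ.⊔ d ℚ.+ ε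
  ⊔-close {c = c} {d} {ε} a≤ b≤ = ℚ.⊔-lub
    (ℚ.≤-trans a≤ (ℚ.+-monoˡ-≤ ε (ℚ.p≤p⊔q c d)))
    (ℚ.≤-trans b≤ (ℚ.+-monoˡ-≤ ε (ℚ.p≤q⊔p c d)))

  ⊓-close : ∀ {a b c d ε} → a ℚ.≤ c ℚ.+ ε → b ℚ.≤ d ℚ.+ ε → a ℚ.⊓ b ℚ.≤ c ℚ.⊓ d ℚ.+ ε
  ⊓-close {a} {b} {c} {d} {ε} a≤ b≤ = subst (a ℚ.⊓ b ℚ.≤_)
    (sym (ℚ.mono-≤-distrib-⊓ (ℚ.+-monoˡ-≤ ε) c d))
    (ℚ.⊓-mono-≤ a≤ b≤)

  abstract
    ⊔-cauchy : ∀ x y → IsCauchy (λ n → seq x n ℚ.⊔ seq y n)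
    ⊔-cauchy (mkℝ x cx) (mkℝ y cy) ε 0<ε =
      let (N , closeˣ) = cx ε 0<ε
          (M , closeʸ) = cy ε 0<ε
      in N ℕ.⊔ M , λ m n le le′ →
      let (N≤m , M≤m) = m⊔n≤o⇒ N M le
          (N≤n , M≤n) = m⊔n≤o⇒ N M le′
      in ≤⇒∣-∣
        (⊔-close {x m} {y m} {x n} {y n}
          (∣-∣⇒≤ (closeˣ m n N≤m N≤n)) (∣-∣⇒≤ {q = y n} (closeʸ m n M≤m M≤n)))
        (⊔-close {x n} {y n} {x m} {y m}
          (∣-∣⇒≤ (closeˣ n m N≤n N≤m)) (∣-∣⇒≤ {q = y m} (closeʸ n m M≤n M≤m)))

    ⊓-cauchy : ∀ x y → IsCauchy (λ n → seq x n ℚ.⊓ seq y n)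
    ⊓-cauchy (mkℝ x cx) (mkℝ y cy) ε 0<ε =
      let (N , closeˣ) = cx ε 0<ε
          (M , closeʸ) = cy ε 0<ε
      in N ℕ.⊔ M , λ m n le le′ →
      let (N≤m , M≤m) = m⊔n≤o⇒ N M le
          (N≤n , M≤n) = m⊔n≤o⇒ N M le′
      in ≤⇒∣-∣
        (⊓-close {x m} {y m} {x n} {y n}
          (∣-∣⇒≤ (closeˣ m n N≤m N≤n)) (∣-∣⇒≤ {q = y n} (closeʸ m n M≤m M≤n)))
        (⊓-close {x n} {y n} {x m} {y m}
          (∣-∣⇒≤ (closeˣ n m N≤n N≤m)) (∣-∣⇒≤ {q = y m} (closeʸ n m M≤n M≤m)))

fromℚ : ℚ → ℝ
fromℚ q = mkℝ (λ _ → q) (const-cauchy q)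

0ᴿ 1ᴿ : ℝ
0ᴿ = fromℚ 0ℚ
1ᴿ = fromℚ 1ℚ

-ᴿ_ : ℝ → ℝ
-ᴿ x = mkℝ (λ n → ℚ.- seq x n) (neg-cauchy x)

_+ᴿ_ _-ᴿ_ _*ᴿ_ _⊔ᴿ_ _⊓ᴿ_ : ℝ → ℝ → ℝ
x +ᴿ y = mkℝ (λ n → seq x n ℚ.+ seq y n) (+-cauchy x y)
x -ᴿ y = x +ᴿ (-ᴿ y)
x *ᴿ y = mkℝ (λ n → seq x n ℚ.* seq y n) (*-cauchy x y)
x ⊔ᴿ y = mkℝ (λ n → seq x n ℚ.⊔ seq y n) (⊔-cauchy x y)
x ⊓ᴿ y = mkℝ (λ n → seq x n ℚ.⊓ seq y n) (⊓-cauchy x y)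

≤ᴿ-refl : ∀ {x} → x ≤ᴿ x
≤ᴿ-refl = mk≤ λ ε 0<ε → 0 , λ n _ → p≤p+ε 0<ε

≤ᴿ-trans : ∀ {x y z} → x ≤ᴿ y → y ≤ᴿ z → x ≤ᴿ z
≤ᴿ-trans {x} {y} {z} x≤y y≤z = mk≤ λ ε 0<ε →
  let (N , p) = within x≤y (ε ℚ.* ½) (half-pos 0<ε)
      (M , q) = within y≤z (ε ℚ.* ½) (half-pos 0<ε)
  in N ℕ.⊔ M , λ n le →
  let (N≤n , M≤n) = m⊔n≤o⇒ N M le
  in ℚ.≤-trans (p n N≤n) (ℚ.≤-trans (ℚ.+-monoˡ-≤ (ε ℚ.* ½) (q n M≤n))
    (ℚ.≤-reflexive (trans (ℚ.+-assoc (seq z n) (ε ℚ.* ½) (ε ℚ.* ½))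
      (cong (seq z n ℚ.+_) (half-half ε)))))

x≤x⊔y : ∀ x y → x ≤ᴿ x ⊔ᴿ y
x≤x⊔y x y = mk≤ λ ε 0<ε → 0 , λ n _ → ℚ.≤-trans (ℚ.p≤p⊔q (seq x n) (seq y n)) (p≤p+ε 0<ε)

y≤x⊔y : ∀ x y → y ≤ᴿ x ⊔ᴿ y
y≤x⊔y x y = mk≤ λ ε 0<ε → 0 , λ n _ → ℚ.≤-trans (ℚ.p≤q⊔p (seq x n) (seq y n)) (p≤p+ε 0<ε)

⊔ᴿ-lub : ∀ {x y z} → x ≤ᴿ z → y ≤ᴿ z → x ⊔ᴿ y ≤ᴿ z
⊔ᴿ-lub x≤z y≤z = mk≤ λ ε 0<ε →
  let (N , p) = within x≤z ε 0<ε
      (M , q) = within y≤z ε 0<ε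
  in N ℕ.⊔ M , λ n le →
  let (N≤n , M≤n) = m⊔n≤o⇒ N M le in ℚ.⊔-lub (p n N≤n) (q n M≤n)

x⊓y≤x : ∀ x y → x ⊓ᴿ y ≤ᴿ x
x⊓y≤x x y = mk≤ λ ε 0<ε → 0 , λ n _ → ℚ.≤-trans (ℚ.p⊓q≤p (seq x n) (seq y n)) (p≤p+ε 0<ε)

x⊓y≤y : ∀ x y → x ⊓ᴿ y ≤ᴿ y
x⊓y≤y x y = mk≤ λ ε 0<ε → 0 , λ n _ → ℚ.≤-trans (ℚ.p⊓q≤q (seq x n) (seq y n)) (p≤p+ε 0<ε)

⊓ᴿ-glb : ∀ {x y z} → z ≤ᴿ x → z ≤ᴿ y → z ≤ᴿ x ⊓ᴿ y
⊓ᴿ-glb {x} {y} {z} z≤x z≤y = mk≤ λ ε 0<ε →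
  let (N , p) = within z≤x ε 0<ε
      (M , q) = within z≤y ε 0<ε
  in N ℕ.⊔ M , λ n le →
  let (N≤n , M≤n) = m⊔n≤o⇒ N M le
  in subst (seq z n ℚ.≤_) (sym (ℚ.mono-≤-distrib-⊓ (ℚ.+-monoˡ-≤ ε) (seq x n) (seq y n)))
       (ℚ.⊓-glb (p n N≤n) (q n M≤n))

sumᴿ : List ℝ → ℝ
sumᴿ = foldr _+ᴿ_ 0ᴿ

-- The membership proof serves to exclude the empty list, on which the
-- maximum is undefined.  It contributes its (already listed) element as
-- the starting value.
maximum minimum : {A : Set} (φ : A → ℝ) {xs : List A} {x : A} → x ∈ xs → ℝ
maximum φ {xs} {x} _ = foldr _⊔ᴿ_ (φ x) (map φ xs)
minimum φ {xs} {x} _ = foldr _⊓ᴿ_ (φ x) (map φ xs)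

-- The supremum of an arbitrary family, as an element of [-∞,∞]
-- represented by its set of real upper bounds: all of ℝ for -∞ (the empty
-- family) and none for +∞.
Upper : Set₁
Upper = ℝ → Set

sup : {I : Set} → (I → ℝ) → Upper
sup c u = ∀ i → c i ≤ᴿ u

infix 4 _≤ᵁ_

_≤ᵁ_ : Upper → Upper → Set
s ≤ᵁ t = ∀ u → t u → s u

IsLub : {I : Set} → (I → ℝ) → ℝ → Set
IsLub c s = (∀ i → c i ≤ᴿ s) × (∀ u → (∀ i → c i ≤ᴿ u) → s ≤ᴿ u)

IsGlb : {I : Set} → (I → ℝ) → ℝ → Set
IsGlb c s = (∀ i → s ≤ᴿ c i) × (∀ u → (∀ i → u ≤ᴿ c i) → u ≤ᴿ s)

≤ᵁ⇔≤ᴿ : {I J : Set} {c : I → ℝ} {d : J → ℝ} {s t : ℝ} →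
         IsLub c s → IsLub d t → (sup c ≤ᵁ sup d) ⇔ (s ≤ᴿ t)
≤ᵁ⇔≤ᴿ {t = t} (c≤s , s-least) (d≤t , t-least) = mk⇔
  (λ h → s-least t (h t d≤t))
  (λ s≤t u d≤u i → ≤ᴿ-trans (c≤s i) (≤ᴿ-trans s≤t (t-least u d≤u)))

maximum-isLub : {A : Set} (φ : A → ℝ) {xs : List A} {x : A} (x∈xs : x ∈ xs) →
  IsLub {∃ (_∈ xs)} (φ ∘ proj₁) (maximum φ x∈xs)
maximum-isLub φ {xs} {x} x∈xs = (λ (y , y∈xs) → upper y∈xs) , least
  where
  upper : ∀ {y ys} → y ∈ ys → φ y ≤ᴿ foldr _⊔ᴿ_ (φ x) (map φ ys)
  upper (here refl) = x≤x⊔y _ _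
  upper (there y∈ys) = ≤ᴿ-trans (upper y∈ys) (y≤x⊔y _ _)
  least : ∀ u → (∀ (p : ∃ (_∈ xs)) → φ (proj₁ p) ≤ᴿ u) → foldr _⊔ᴿ_ (φ x) (map φ xs) ≤ᴿ u
  least u h = go xs (λ y∈xs → h (_ , y∈xs))
    where
    go : ∀ ys → (∀ {y} → y ∈ ys → φ y ≤ᴿ u) → foldr _⊔ᴿ_ (φ x) (map φ ys) ≤ᴿ u
    go []       k = h (x , x∈xs)
    go (y ∷ ys) k = ⊔ᴿ-lub (k (here refl)) (go ys (k ∘ there))

minimum-isGlb : {A : Set} (φ : A → ℝ) {xs : List A} {x : A} (x∈xs : x ∈ xs) →
  IsGlb {∃ (_∈ xs)} (φ ∘ proj₁) (minimum φ x∈xs)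
minimum-isGlb φ {xs} {x} x∈xs = (λ (y , y∈xs) → lower y∈xs) , greatest
  where
  lower : ∀ {y ys} → y ∈ ys → foldr _⊓ᴿ_ (φ x) (map φ ys) ≤ᴿ φ y
  lower (here refl) = x⊓y≤x _ _
  lower (there y∈ys) = ≤ᴿ-trans (x⊓y≤y _ _) (lower y∈ys)
  greatest : ∀ u → (∀ (p : ∃ (_∈ xs)) → u ≤ᴿ φ (proj₁ p)) → u ≤ᴿ foldr _⊓ᴿ_ (φ x) (map φ xs)
  greatest u h = go xs (λ y∈xs → h (_ , y∈xs))
    where
    go : ∀ ys → (∀ {y} → y ∈ ys → u ≤ᴿ φ y) → u ≤ᴿ foldr _⊓ᴿ_ (φ x) (map φ ys)
    go []       k = h (x , x∈xs)
    go (y ∷ ys) k = ⊓ᴿ-glb (k (here refl)) (go ys (k ∘ there))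

record Distribution (A : Set) : Set where
  field
    support : List (ℝ × A)
    nonneg  : All (λ (p , _) → 0ᴿ ≤ᴿ p) support
    total   : sumᴿ (map proj₁ support) ≈ᴿ 1ᴿ

open Distribution public

𝔼 : {A : Set} → Distribution A → (A → ℝ) → ℝ
𝔼 d φ = sumᴿ (map (λ (p , a) → p *ᴿ φ a) (support d))

dirac : {A : Set} → A → Distribution A
dirac a = record
  { support = (1ᴿ , a) ∷ []
  ; nonneg  = mk≤ (λ ε 0<ε → 0 , λ _ _ →
      ℚ.≤-trans (ℚ.<⇒≤ (ℚ.positive⁻¹ 1ℚ)) (p≤p+ε 0<ε)) ∷ []
  ; total   = mk≤ (λ ε 0<ε → 0 , λ _ _ → p≤p+ε 0<ε)
            , mk≤ (λ ε 0<ε → 0 , λ _ _ → p≤p+ε 0<ε)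
  }

infixl 6 _⊕_

_⊕_ : ∀ {n} → Vec ℕ n → Vec ℕ n → Vec ℕ n
_⊕_ = zipWith ℕ._+_

_⟨_⟩ : ∀ {n} → Vec ℕ n → Subset n → ℕ
x ⟨ A ⟩ = Vec.sum (zipWith (λ side k → if side then k else 0) A x)

sumOfSmallest : ∀ {n} → ℕ → Vec ℕ n → ℕ
sumOfSmallest k x = sum (take k (sort ℕ.≤-decTotalOrder (toList x)))

infix 4 _⪯_ _⪰_

_⪰_ : ∀ {n} → Vec ℕ n → Vec ℕ n → Set
_⪰_ {n} x y = x ⟨ ⊤ ⟩ ≡ y ⟨ ⊤ ⟩ ×
  (∀ k → 1 ℕ.≤ k → k ℕ.≤ n → sumOfSmallest k x ℕ.≤ sumOfSmallest k y)

_⪯_ : ∀ {n} → Vec ℕ n → Vec ℕ n → Set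
x ⪯ y = y ⪰ x

NonNegative SchurConcave SchurConvex : ∀ {n} → (Vec ℕ n → ℝ) → Set
NonNegative  f = ∀ x → 0ᴿ ≤ᴿ f x
SchurConcave f = ∀ x y → x ⪯ y → f y ≤ᴿ f x
SchurConvex  g = ∀ x y → x ⪯ y → g x ≤ᴿ g y

record Polymatroid (n : ℕ) : Set where
  field
    r          : Subset n → ℕ
    normalized : r ⊥ ≡ 0
    monotone   : ∀ A B → A ⊆ B → r A ℕ.≤ r B
    submodular : ∀ A B → r (A ∩ B) ℕ.+ r (A ∪ B) ℕ.≤ r A ℕ.+ r B

open Polymatroid public

Rank : ∀ {n} → Polymatroid n → ℕ
Rank P = r P ⊤

_∈ᴾ_ : ∀ {n} → Vec ℕ n → Polymatroid n → Set
x ∈ᴾ P = ∀ A → x ⟨ A ⟩ ℕ.≤ r P A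

IsBasis : ∀ {n} → Polymatroid n → Vec ℕ n → Set
IsBasis P x = x ∈ᴾ P × x ⟨ ⊤ ⟩ ≡ Rank P

-- The proof is irrelevant, so that bases with the same vector are equal.
record Basis {n} (P : Polymatroid n) : Set where
  constructor mkBasis
  field
    vec      : Vec ℕ n
    .isBasis : IsBasis P vec

open Basis public using (vec)

_∈ᴾ?_ : ∀ {n} (x : Vec ℕ n) (P : Polymatroid n) → Dec (x ∈ᴾ P)
x ∈ᴾ? P = Dec.map′
  (λ none A → decidable-stable (x ⟨ A ⟩ ℕ.≤? r P A) (λ x≰r → none (A , x≰r)))
  (λ x∈P (A , x≰r) → x≰r (x∈P A))
  (¬? (anySubset? (λ A → ¬? (x ⟨ A ⟩ ℕ.≤? r P A))))

isBasis? : ∀ {n} (P : Polymatroid n) (x : Vec ℕ n) → Dec (IsBasis P x)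
isBasis? P x = (x ∈ᴾ? P) ×-dec (x ⟨ ⊤ ⟩ ℕ.≟ Rank P)

box : ∀ n → ℕ → List (Vec ℕ n)
box zero    b = [] ∷ []
box (suc n) b = cartesianProductWith _∷_ (upTo (suc b)) (box n b)

bases : ∀ {n} → Polymatroid n → List (Vec ℕ n)
bases {n} P = filter (isBasis? P) (box n (Rank P))

∈-box : ∀ {n} (x : Vec ℕ n) {b} → x ⟨ ⊤ ⟩ ℕ.≤ b → x ∈ box n b
∈-box []      _   = here refl
∈-box (k ∷ x) {b} le = ∈-cartesianProductWith⁺ _∷_
  (∈-upTo⁺ (ℕ.s≤s (ℕ.≤-trans (ℕ.m≤m+n k (x ⟨ ⊤ ⟩)) le)))
  (∈-box x (ℕ.≤-trans (ℕ.m≤n+m (x ⟨ ⊤ ⟩) k) le))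

∈-bases : ∀ {n} (P : Polymatroid n) (x : Vec ℕ n) → x ∈ bases P ⇔ IsBasis P x
∈-bases {n} P x = mk⇔
  (λ x∈ → proj₂ (∈-filter⁻ (isBasis? P) {xs = box n (Rank P)} x∈))
  (λ b → ∈-filter⁺ (isBasis? P) (∈-box x (ℕ.≤-reflexive (proj₂ b))) b)

basis-∈ : ∀ {n} {P : Polymatroid n} (x : Basis P) → vec x ∈ bases P
basis-∈ {P = P} (mkBasis x b) = ∈-filter⁺ (isBasis? P)
  (∈-box x (ℕ.≤-reflexive (proj₂ b′))) b′
  where b′ = recompute (isBasis? P x) b

-- The completed rounds, most recent first.
History : ℕ → Set
History n = List (Σ (Polymatroid n) Basis)

totalRank : ∀ {n} → History n → ℕ
totalRank []            = 0
totalRank ((P , _) ∷ h) = Rank P ℕ.+ totalRank h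

load : ∀ {n} → History n → Vec ℕ n
load []            = replicate _ 0
load ((_ , x) ∷ h) = vec x ⊕ load h

-- The set H of all loads Σ zₜ with zₜ a basis of the t-th polymatroid.
achievable : ∀ {n} → History n → List (Vec ℕ n)
achievable []            = replicate _ 0 ∷ []
achievable ((P , _) ∷ h) = cartesianProductWith _⊕_ (bases P) (achievable h)

load∈achievable : ∀ {n} (h : History n) → load h ∈ achievable h
load∈achievable []            = here refl
load∈achievable ((_ , x) ∷ h) = ∈-cartesianProductWith⁺ _⊕_ (basis-∈ x) (load∈achievable h)

-- Starting from history h and presenting the polymatroids chosen by next,
-- the game ends after finitely many rounds with total rank exactly m,
-- whatever bases are selected.  As ranks are nonnegative, overshooting m
-- rules this out.
data Ends {n} (next : History n → Polymatroid n) (m : ℕ) (h : History n) : Set where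
  done : totalRank h ≡ m → Ends next m h
  step : totalRank h ≢ m → (∀ x → Ends next m ((next h , x) ∷ h)) → Ends next m h

record Adversary (n m : ℕ) : Set where
  field
    next : History n → Polymatroid n
    ends : Ends next m []

open Adversary public

-- A randomized strategy: the distribution of the selected basis given the
-- history and the presented polymatroid.  As the set of bases is finite,
-- finitely supported distributions are all of them.
Allocation : ℕ → Set
Allocation n = History n → (P : Polymatroid n) → Distribution (Basis P)

DeterministicAllocation : ℕ → Set
DeterministicAllocation n = History n → (P : Polymatroid n) → Basis P

deterministic : ∀ {n} → DeterministicAllocation n → Allocation n
deterministic D h P = dirac (D h P)

-- The brick-laying strategies are those given by the possible tie-breaking
-- rules.
IsBrickLaying : ∀ {n} → DeterministicAllocation n → Set
IsBrickLaying {n} D = ∀ (h : History n) (P : Polymatroid n) (x : Basis P) →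
  load h ⊕ vec (D h P) ⪯ load h ⊕ vec x

expectedFrom : ∀ {n m} → Allocation n → (History n → ℝ) →
  (next : History n → Polymatroid n) {h : History n} → Ends next m h → ℝ
expectedFrom A φ next {h} (done _)   = φ h
expectedFrom A φ next {h} (step _ k) =
  𝔼 (A h (next h)) (λ x → expectedFrom A φ next (k x))

expected : ∀ {n m} → Allocation n → Adversary n m → (History n → ℝ) → ℝ
expected A P φ = expectedFrom A φ (next P) (ends P)

maxCost minCost : ∀ {n m} → (Vec ℕ n → ℝ) → ℝ → Allocation n → Adversary n m → ℝ
maxCost f α A P = expected A P λ h → α *ᴿ maximum f (load∈achievable h) -ᴿ f (load h)
minCost g α A P = expected A P λ h → g (load h) -ᴿ α *ᴿ minimum g (load∈achievable h)

maxRegret minRegret : ∀ n m → (Vec ℕ n → ℝ) → ℝ → Allocation n → Upper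
maxRegret n m f α A = sup {Adversary n m} (maxCost f α A)
minRegret n m g α A = sup {Adversary n m} (minCost g α A)

{-# OPTIONS --safe #-}

-- Let L be the final load of brick-laying and z any alternative load.  In each
-- round the units that brick-laying puts above height k cannot be moved to
-- agents below height k, so a tight set forces every basis to give at least as
-- many units to the agents of height at least k.  Summing over the rounds, z
-- gives the agents with L ≥ k at least Σᵢ (Lᵢ - k)⁺ units, for every k.
--
-- Against an arbitrary strategy, present L layer by layer: in round k + 1 as
-- many units as there are agents with L > k, to be distributed freely over the
-- currently most loaded agents, as many as there are with L ≥ k.  These sets
-- are nested, since the agents dropped never receive units again, and by
-- averaging they keep enough load for the final load to majorize L.  By the
-- inequalities for z, a permutation of z (matching the agents sorted by the
-- final load with those sorted by L) splits into bases of the layers.  So the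
-- strategy ends up with a load no better than L against an alternative at
-- least as good as z.
module Submission where

open import Defs
open import Data.Bool.Base using (T; true; false; _∧_; _∨_; if_then_else_)
open import Data.Fin.Base using (Fin; zero; suc; toℕ; fromℕ<; punchOut)
open import Data.Fin.Permutation as Perm
  using (Permutation′; _⟨$⟩ʳ_; _⟨$⟩ˡ_; _∘ₚ_; flip; permutation)
open import Data.Fin.Properties as Fin
  using (any?; toℕ<n; toℕ-injective; toℕ-fromℕ<; punchOut-injective; <⇒notInjective)
open import Data.Fin.Subset using (Subset; ⊤; ⊥; _∩_; _∪_; ∁; ∣_∣; _∈_; _∉_; _⊆_; Nonempty)
open import Data.Fin.Subset.Properties
open import Data.List.Base as List using (List; []; _∷_; foldr; length; take)
open import Data.List.Membership.Propositional using () renaming (_∈_ to infix 4 _∈ˡ_)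
open import Data.List.Membership.Propositional.Properties
  using (∈-cartesianProductWith⁺; ∈-cartesianProductWith⁻)
open import Data.List.Relation.Binary.Permutation.Propositional.Properties using (map⁺; ↭-length)
open import Data.List.Relation.Unary.All as All using (All; []; _∷_)
open import Data.List.Relation.Unary.AllPairs using (AllPairs; []; _∷_)
open import Data.List.Relation.Unary.Any using (here; there)
open import Data.List.Relation.Unary.Linked.Properties using (Linked⇒AllPairs)
open import Data.List.Sort using (sort; sort-↭; sort-↗)
open import Data.Nat.Base as ℕ
open import Data.Nat.DivMod using (_%_; [m+kn]%n≡m%n; m<n⇒m%n≡m)
open import Data.Nat.ListAction as ListAction using ()
open import Data.Nat.ListAction.Properties using (sum-↭)
open import Data.Nat.Properties as ℕ
open import Data.Nat.Tactic.RingSolver using (solve-∀)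
open import Data.Product.Base using (_×_; _,_; proj₁; proj₂; ∃)
open import Data.Rational.Base as ℚ using (ℚ; 0ℚ; 1ℚ; ½)
import Data.Rational.Properties as ℚ
open import Data.Rational.Solver using (module +-*-Solver)
open import Data.Sum.Base as Sum using (_⊎_; inj₁; inj₂; [_,_]′)
open import Data.Vec.Base as Vec using (Vec; []; _∷_; lookup; replicate; tabulate; toList)
open import Data.Vec.Properties
  using (lookup-map; lookup-replicate; lookup-zipWith; lookup∘tabulate; map-replicate;
         tabulate-cong; tabulate-∘; []=⇒lookup; lookup⇒[]=; length-toList;
         zipWith-assoc; zipWith-comm; zipWith-identityʳ)
open import Function.Base using (_∘_; id; case_of_)
open import Function.Bundles using (Equivalence)
open import Function.Definitions using (Injective)
open import Level using (0ℓ)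
open import Relation.Binary.Definitions using (tri<; tri≈; tri>)
open import Relation.Binary.PropositionalEquality
open import Relation.Nullary using (Dec; yes; no; does; ¬_; contradiction)
open import Relation.Nullary.Decidable using (_×-dec_; ¬?; decidable-stable)
open import Relation.Unary using (Pred; Decidable)
open import Algebra.Properties.CommutativeMonoid.Sum +-0-commutativeMonoid
  using (sum; sum-cong-≗; ∑-distrib-+; sum-permute)
open import Algebra.Properties.CommutativeSemigroup +-commutativeSemigroup using (interchange)

private
  variable
    n : ℕ

sum-mono-≤ : {f g : Fin n → ℕ} → (∀ i → f i ≤ g i) → sum f ≤ sum g
sum-mono-≤ {zero}  f≤g = z≤n
sum-mono-≤ {suc n} f≤g = +-mono-≤ (f≤g zero) (sum-mono-≤ (f≤g ∘ suc))

-- Sums over sets of agents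

⟪_⟫ : {P : Pred (Fin n) 0ℓ} → Decidable P → Subset n
⟪ P? ⟫ = tabulate (does ∘ P?)

∈⟪⟫⁺ : {P : Pred (Fin n) 0ℓ} (P? : Decidable P) {i : Fin n} → P i → i ∈ ⟪ P? ⟫
∈⟪⟫⁺ P? {i} p = lookup⇒[]= i _ (trans (lookup∘tabulate (does ∘ P?) i) eq)
  where
  eq : does (P? i) ≡ true
  eq with P? i
  ... | yes _ = refl
  ... | no ¬p = contradiction p ¬p

∈⟪⟫⁻ : {P : Pred (Fin n) 0ℓ} (P? : Decidable P) {i : Fin n} → i ∈ ⟪ P? ⟫ → P i
∈⟪⟫⁻ {P = P} P? {i} i∈ = go (trans (sym (lookup∘tabulate (does ∘ P?) i)) ([]=⇒lookup i∈))
  where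
  go : does (P? i) ≡ true → P i
  go eq with P? i
  go _  | yes p = p
  go () | no _

infixl 7 _↾_

-- The summands of `x ⟨ A ⟩` as a function of the agent, so that relations between such sums can be
-- proved agent by agent.
_↾_ : Vec ℕ n → Subset n → Fin n → ℕ
(x ↾ A) i = if lookup A i then lookup x i else 0

↾-∈ : (x : Vec ℕ n) {A : Subset n} {i : Fin n} → i ∈ A → (x ↾ A) i ≡ lookup x i
↾-∈ x {i = i} i∈A = cong (if_then lookup x i else 0) ([]=⇒lookup i∈A)

↾-∉ : (x : Vec ℕ n) {A : Subset n} {i : Fin n} → i ∉ A → (x ↾ A) i ≡ 0
↾-∉ x {A} {i} i∉A with lookup A i in eq
... | true  = contradiction (lookup⇒[]= i A eq) i∉A
... | false = refl

⟨⟩≡sum : (x : Vec ℕ n) (A : Subset n) → x ⟨ A ⟩ ≡ sum (x ↾ A)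
⟨⟩≡sum []      []      = refl
⟨⟩≡sum (k ∷ x) (s ∷ A) = cong ((if s then k else 0) +_) (⟨⟩≡sum x A)

⟨⟩-mono : (x y : Vec ℕ n) (A B : Subset n) →
  (∀ i → (x ↾ A) i ≤ (y ↾ B) i) → x ⟨ A ⟩ ≤ y ⟨ B ⟩
⟨⟩-mono x y A B le = subst₂ _≤_ (sym (⟨⟩≡sum x A)) (sym (⟨⟩≡sum y B)) (sum-mono-≤ le)

private
  ⟨⟩-+ : (x y : Vec ℕ n) (A B : Subset n) →
    x ⟨ A ⟩ + y ⟨ B ⟩ ≡ sum (λ i → (x ↾ A) i + (y ↾ B) i)
  ⟨⟩-+ x y A B = trans (cong₂ _+_ (⟨⟩≡sum x A) (⟨⟩≡sum y B)) (sym (∑-distrib-+ (x ↾ A) (y ↾ B)))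

⟨⟩-+-mono : (x y z w : Vec ℕ n) (A B C D : Subset n) →
  (∀ i → (x ↾ A) i + (y ↾ B) i ≤ (z ↾ C) i + (w ↾ D) i) →
  x ⟨ A ⟩ + y ⟨ B ⟩ ≤ z ⟨ C ⟩ + w ⟨ D ⟩
⟨⟩-+-mono x y z w A B C D le =
  subst₂ _≤_ (sym (⟨⟩-+ x y A B)) (sym (⟨⟩-+ z w C D)) (sum-mono-≤ le)

⟨⟩-≤-+ : (x y z : Vec ℕ n) (A B C : Subset n) →
  (∀ i → (x ↾ A) i ≤ (y ↾ B) i + (z ↾ C) i) → x ⟨ A ⟩ ≤ y ⟨ B ⟩ + z ⟨ C ⟩
⟨⟩-≤-+ x y z A B C le =
  subst₂ _≤_ (sym (⟨⟩≡sum x A)) (sym (⟨⟩-+ y z B C)) (sum-mono-≤ le)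

⟨⟩-+-cong : (x y z w : Vec ℕ n) (A B C D : Subset n) →
  (∀ i → (x ↾ A) i + (y ↾ B) i ≡ (z ↾ C) i + (w ↾ D) i) →
  x ⟨ A ⟩ + y ⟨ B ⟩ ≡ z ⟨ C ⟩ + w ⟨ D ⟩
⟨⟩-+-cong x y z w A B C D eq =
  trans (⟨⟩-+ x y A B) (trans (sum-cong-≗ eq) (sym (⟨⟩-+ z w C D)))

⟨⟩-mono-⊆ : (x : Vec ℕ n) {A B : Subset n} → A ⊆ B → x ⟨ A ⟩ ≤ x ⟨ B ⟩
⟨⟩-mono-⊆ x {A} {B} A⊆B = ⟨⟩-mono x x A B λ i → case i ∈? A of λ where
  (yes i∈A) → ≤-reflexive (trans (↾-∈ x i∈A) (sym (↾-∈ x (A⊆B i∈A))))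
  (no  i∉A) → subst (_≤ (x ↾ B) i) (sym (↾-∉ x i∉A)) z≤n

⟨⟩-∁ : (x : Vec ℕ n) (A : Subset n) → x ⟨ A ⟩ + x ⟨ ∁ A ⟩ ≡ x ⟨ ⊤ ⟩
⟨⟩-∁ []      []          = refl
⟨⟩-∁ (k ∷ x) (true  ∷ A) = trans (+-assoc k (x ⟨ A ⟩) (x ⟨ ∁ A ⟩)) (cong (k +_) (⟨⟩-∁ x A))
⟨⟩-∁ (k ∷ x) (false ∷ A) = begin
  x ⟨ A ⟩ + (k + x ⟨ ∁ A ⟩) ≡⟨ +-comm (x ⟨ A ⟩) _ ⟩
  k + x ⟨ ∁ A ⟩ + x ⟨ A ⟩   ≡⟨ +-assoc k _ _ ⟩
  k + (x ⟨ ∁ A ⟩ + x ⟨ A ⟩) ≡⟨ cong (k +_) (trans (+-comm (x ⟨ ∁ A ⟩) _) (⟨⟩-∁ x A)) ⟩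
  k + x ⟨ ⊤ ⟩               ∎
  where open ≡-Reasoning

⟨⟩-∩∪ : (x : Vec ℕ n) (A B : Subset n) → x ⟨ A ∩ B ⟩ + x ⟨ A ∪ B ⟩ ≡ x ⟨ A ⟩ + x ⟨ B ⟩
⟨⟩-∩∪ x A B = ⟨⟩-+-cong x x x x (A ∩ B) (A ∪ B) A B pointwise
  where
  pointwise : ∀ i → (x ↾ (A ∩ B)) i + (x ↾ (A ∪ B)) i ≡ (x ↾ A) i + (x ↾ B) i
  pointwise i rewrite lookup-zipWith _∧_ i A B | lookup-zipWith _∨_ i A B
    with lookup A i | lookup B i
  ... | true  | true  = refl
  ... | true  | false = sym (+-identityʳ _)
  ... | false | true  = refl
  ... | false | false = refl

⟨⟩-⊕ : (x y : Vec ℕ n) (A : Subset n) → (x ⊕ y) ⟨ A ⟩ ≡ x ⟨ A ⟩ + y ⟨ A ⟩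
⟨⟩-⊕ []      []      []          = refl
⟨⟩-⊕ (k ∷ x) (l ∷ y) (true  ∷ A) = begin
  k + l + (x ⊕ y) ⟨ A ⟩         ≡⟨ cong (k + l +_) (⟨⟩-⊕ x y A) ⟩
  k + l + (x ⟨ A ⟩ + y ⟨ A ⟩)   ≡⟨ interchange k l (x ⟨ A ⟩) (y ⟨ A ⟩) ⟩
  k + x ⟨ A ⟩ + (l + y ⟨ A ⟩)   ∎
  where open ≡-Reasoning
⟨⟩-⊕ (k ∷ x) (l ∷ y) (false ∷ A) = ⟨⟩-⊕ x y A

⟨⟩-replicate : (c : ℕ) (A : Subset n) → replicate n c ⟨ A ⟩ ≡ ∣ A ∣ * c
⟨⟩-replicate c []          = refl
⟨⟩-replicate c (true  ∷ A) = cong (c +_) (⟨⟩-replicate c A)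
⟨⟩-replicate c (false ∷ A) = ⟨⟩-replicate c A

⟨⊥⟩ : (x : Vec ℕ n) → x ⟨ ⊥ ⟩ ≡ 0
⟨⊥⟩ []      = refl
⟨⊥⟩ (k ∷ x) = ⟨⊥⟩ x

lookup-⊕ : (x y : Vec ℕ n) (i : Fin n) → lookup (x ⊕ y) i ≡ lookup x i + lookup y i
lookup-⊕ x y i = lookup-zipWith _+_ i x y

-- Majorization

-- Majorization is tested on the functions v ↦ Σᵢ min(vᵢ, c), which need no
-- sorting: Σᵢ min(vᵢ, c) is the minimum over k of the sum of the k smallest
-- entries plus (n - k) c, and dually.
cap excess : ℕ → Vec ℕ n → ℕ
cap    c v = Vec.map (_⊓ c) v ⟨ ⊤ ⟩
excess c v = Vec.map (_∸ c) v ⟨ ⊤ ⟩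

private
  capᴸ : ℕ → List ℕ → ℕ
  capᴸ c xs = ListAction.sum (List.map (_⊓ c) xs)

  capᴸ≤ : ∀ k c xs → capᴸ c xs ≤ ListAction.sum (take k xs) + (length xs ∸ k) * c
  capᴸ≤ zero    c []       = z≤n
  capᴸ≤ zero    c (x ∷ xs) = +-mono-≤ (m⊓n≤n x c) (capᴸ≤ zero c xs)
  capᴸ≤ (suc k) c []       = z≤n
  capᴸ≤ (suc k) c (x ∷ xs) = ≤-trans (+-mono-≤ (m⊓n≤m x c) (capᴸ≤ k c xs))
    (≤-reflexive (sym (+-assoc x (ListAction.sum (take k xs)) _)))

  ≤capᴸ-of-large : ∀ {c xs} → All (c ≤_) xs → length xs * c ≤ capᴸ c xs
  ≤capᴸ-of-large []          = z≤n
  ≤capᴸ-of-large (c≤x ∷ all) = +-mono-≤ (≤-reflexive (sym (m≥n⇒m⊓n≡n c≤x))) (≤capᴸ-of-large all)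

  ≤capᴸ-∷ : ∀ k {c x xs} → x ≤ c → ListAction.sum (take k xs) + (length xs ∸ k) * c ≤ capᴸ c xs →
    ListAction.sum (take (suc k) (x ∷ xs)) + (length (x ∷ xs) ∸ suc k) * c ≤ capᴸ c (x ∷ xs)
  ≤capᴸ-∷ k {c} {x} {xs} x≤c le = ≤-trans
    (≤-reflexive (+-assoc x (ListAction.sum (take k xs)) _))
    (+-mono-≤ (≤-reflexive (sym (m≤n⇒m⊓n≡m x≤c))) le)

  -- The level `c` is the last of the first `k` entries, or `b` if there is none. The recursion
  -- hands each entry on as the lower bound `b`, which keeps the entries already taken at most `c`.
  cap-tight-for-length : ∀ k {b xs} → AllPairs _≤_ xs → All (b ≤_) xs →
    ∃ λ c → b ≤ c × ListAction.sum (take k xs) + (length xs ∸ k) * c ≤ capᴸ c xs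
  cap-tight-for-length zero    {b}     _        b≤xs = b , ≤-refl , ≤capᴸ-of-large b≤xs
  cap-tight-for-length (suc k) {b} {[]} _       _    = b , ≤-refl , z≤n
  cap-tight-for-length (suc k) (x≤xs ∷ xs↗) (b≤x ∷ _) =
    let (c , x≤c , le) = cap-tight-for-length k xs↗ x≤xs
    in c , ≤-trans b≤x x≤c , ≤capᴸ-∷ k x≤c le

  -- Take entries as long as they are at most `c`; by sortedness all the remaining ones are at least
  -- `c`.
  cap-tight-for-level : ∀ c {xs} → AllPairs _≤_ xs →
    ∃ λ k → k ≤ length xs × ListAction.sum (take k xs) + (length xs ∸ k) * c ≤ capᴸ c xs
  cap-tight-for-level c []           = 0 , z≤n , z≤n
  cap-tight-for-level c {x ∷ _} (x≤xs ∷ xs↗) with ≤-total x c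
  ... | inj₁ x≤c =
    let (k , k≤ , le) = cap-tight-for-level c xs↗
    in suc k , s≤s k≤ , ≤capᴸ-∷ k x≤c le
  ... | inj₂ c≤x = 0 , z≤n , ≤capᴸ-of-large (c≤x ∷ All.map (≤-trans c≤x) x≤xs)

  sorted : Vec ℕ n → List ℕ
  sorted v = sort ≤-decTotalOrder (toList v)

  sorted-increasing : (v : Vec ℕ n) → AllPairs _≤_ (sorted v)
  sorted-increasing v = Linked⇒AllPairs ≤-trans (sort-↗ ≤-decTotalOrder (toList v))

  length-sorted : (v : Vec ℕ n) → length (sorted v) ≡ n
  length-sorted v = trans (↭-length (sort-↭ ≤-decTotalOrder (toList v))) (length-toList v)

  capᴸ-sorted : ∀ c (v : Vec ℕ n) → capᴸ c (sorted v) ≡ cap c v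
  capᴸ-sorted c v = trans (sum-↭ (map⁺ (_⊓ c) (sort-↭ ≤-decTotalOrder (toList v)))) (go v)
    where
    go : ∀ {n} (v : Vec ℕ n) → capᴸ c (toList v) ≡ cap c v
    go []      = refl
    go (k ∷ v) = cong (k ⊓ c +_) (go v)

  cap≤ : ∀ k c (v : Vec ℕ n) → cap c v ≤ sumOfSmallest k v + (n ∸ k) * c
  cap≤ k c v = subst₂ (λ a l → a ≤ sumOfSmallest k v + (l ∸ k) * c)
    (capᴸ-sorted c v) (length-sorted v) (capᴸ≤ k c (sorted v))

-- Choose `k` so that the bound of `cap c x` by the `k` smallest entries is attained; the same `k`
-- bounds `cap c y` from above.
⪯⇒cap≥ : {x y : Vec ℕ n} → x ⪯ y → ∀ c → cap c y ≤ cap c x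
⪯⇒cap≥ {n} {x} {y} (_ , x⪯y) c with cap-tight-for-level c (sorted-increasing x)
... | k , k≤ , le = ≤-trans (cap≤ k c y) (≤-trans
    (+-monoˡ-≤ ((n ∸ k) * c) (smallest k (subst (k ≤_) (length-sorted x) k≤)))
    (subst₂ (λ a l → sumOfSmallest k x + (l ∸ k) * c ≤ a) (capᴸ-sorted c x) (length-sorted x) le))
  where
  smallest : ∀ k → k ≤ n → sumOfSmallest k y ≤ sumOfSmallest k x
  smallest zero    _  = z≤n
  smallest (suc k) k≤ = x⪯y (suc k) (s≤s z≤n) k≤

-- Dually, for given `k` choose `c` so that the bound of `cap c y` by the `k` smallest entries is
-- attained.
cap≥⇒⪯ : {x y : Vec ℕ n} → x ⟨ ⊤ ⟩ ≡ y ⟨ ⊤ ⟩ → (∀ c → cap c y ≤ cap c x) → x ⪯ y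
cap≥⇒⪯ {n} {x} {y} total≡ cap≥ = sym total≡ , λ k _ _ →
  let (c , _ , le) = cap-tight-for-length k (sorted-increasing y) (All.universal (λ _ → z≤n) _)
  in +-cancelʳ-≤ ((n ∸ k) * c) _ _ (≤-trans
       (subst₂ (λ a l → sumOfSmallest k y + (l ∸ k) * c ≤ a) (capᴸ-sorted c y) (length-sorted y) le)
       (≤-trans (cap≥ c) (cap≤ k c x)))

cap+excess : ∀ c (v : Vec ℕ n) → cap c v + excess c v ≡ v ⟨ ⊤ ⟩
cap+excess c []      = refl
cap+excess c (k ∷ v) = trans (interchange (k ⊓ c) (cap c v) (k ∸ c) (excess c v))
  (cong₂ _+_ (trans (cong (_+ (k ∸ c)) (⊓-comm k c)) (m⊓n+n∸m≡n c k)) (cap+excess c v))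

⊕-assoc : (x y z : Vec ℕ n) → (x ⊕ y) ⊕ z ≡ x ⊕ (y ⊕ z)
⊕-assoc = zipWith-assoc +-assoc

⊕-comm : (x y : Vec ℕ n) → x ⊕ y ≡ y ⊕ x
⊕-comm = zipWith-comm +-comm

⊕-identityʳ : (x : Vec ℕ n) → x ⊕ replicate n 0 ≡ x
⊕-identityʳ = zipWith-identityʳ +-identityʳ

-- Exchanges and tight sets

unit : Fin n → Vec ℕ n
unit zero    = 1 ∷ replicate _ 0
unit (suc i) = 0 ∷ unit i

lookup-unit : (i : Fin n) → lookup (unit i) i ≡ 1
lookup-unit zero    = refl
lookup-unit (suc i) = lookup-unit i

unit⟨⟩-∈ : {a : Fin n} {A : Subset n} → a ∈ A → unit a ⟨ A ⟩ ≡ 1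
unit⟨⟩-∈ {suc n} {zero} {_ ∷ A} Vec.here = cong suc (trans (⟨⟩-replicate 0 A) (*-zeroʳ ∣ A ∣))
unit⟨⟩-∈ {a = suc a} {true  ∷ A} (Vec.there a∈A) = unit⟨⟩-∈ a∈A
unit⟨⟩-∈ {a = suc a} {false ∷ A} (Vec.there a∈A) = unit⟨⟩-∈ a∈A

unit⟨⟩-∉ : {a : Fin n} {A : Subset n} → a ∉ A → unit a ⟨ A ⟩ ≡ 0
unit⟨⟩-∉ {a = a} {A} a∉A = +-cancelˡ-≡ 1 _ _ (begin
  1 + unit a ⟨ A ⟩                ≡⟨ cong (_+ unit a ⟨ A ⟩) (sym (unit⟨⟩-∈ (x∉p⇒x∈∁p a∉A))) ⟩
  unit a ⟨ ∁ A ⟩ + unit a ⟨ A ⟩   ≡⟨ +-comm (unit a ⟨ ∁ A ⟩) _ ⟩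
  unit a ⟨ A ⟩ + unit a ⟨ ∁ A ⟩   ≡⟨ ⟨⟩-∁ (unit a) A ⟩
  unit a ⟨ ⊤ ⟩                    ≡⟨ unit⟨⟩-∈ {a = a} ∈⊤ ⟩
  1                               ∎)
  where open ≡-Reasoning

split-unit : (x : Vec ℕ n) (a : Fin n) → 1 ≤ lookup x a → ∃ λ y → y ⊕ unit a ≡ x
split-unit (suc k ∷ x) zero    _  = k ∷ x , cong₂ _∷_ (+-comm k 1) (⊕-identityʳ x)
split-unit (k ∷ x)     (suc a) le =
  let (y , eq) = split-unit x a le in k ∷ y , cong₂ _∷_ (+-identityʳ k) eq

cap-⊕-unit-above : ∀ {k} (u : Vec ℕ n) (a : Fin n) → k ≤ lookup u a →
  cap k (u ⊕ unit a) ≡ cap k u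
cap-⊕-unit-above {k = k} (l ∷ u) zero le = cong₂ _+_
  (trans (m≥n⇒m⊓n≡n (≤-trans le (m≤m+n l 1))) (sym (m≥n⇒m⊓n≡n le)))
  (cong (cap k) (⊕-identityʳ u))
cap-⊕-unit-above {k = k} (l ∷ u) (suc a) le = cong₂ _+_
  (cong (_⊓ k) (+-identityʳ l)) (cap-⊕-unit-above u a le)

cap-⊕-unit-below : ∀ {k} (u : Vec ℕ n) (b : Fin n) → lookup u b < k →
  cap k (u ⊕ unit b) ≡ suc (cap k u)
cap-⊕-unit-below {k = k} (l ∷ u) zero lt = cong₂ _+_
  (trans (m≤n⇒m⊓n≡m (≤-trans (≤-reflexive (+-comm l 1)) lt))
    (trans (+-comm l 1) (cong suc (sym (m≤n⇒m⊓n≡m (<⇒≤ lt))))))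
  (cong (cap k) (⊕-identityʳ u))
cap-⊕-unit-below {k = k} (l ∷ u) (suc b) lt = trans (cong₂ _+_
  (cong (_⊓ k) (+-identityʳ l)) (cap-⊕-unit-below u b lt)) (+-suc (l ⊓ k) (cap k u))

Tight : Polymatroid n → Vec ℕ n → Subset n → Set
Tight P x A = x ⟨ A ⟩ ≡ r P A

-- The map `A ↦ x ⟨ A ⟩` is modular and `r P` is submodular, so the two bounds for `A ∩ B` and
-- `A ∪ B` leave no slack in their sum, hence none in either.
tight-∩∪ : (P : Polymatroid n) {x : Vec ℕ n} → x ∈ᴾ P → ∀ A B →
  Tight P x A → Tight P x B → Tight P x (A ∩ B) × Tight P x (A ∪ B)
tight-∩∪ P {x} x∈P A B tA tB =
  ≤-antisym (x∈P (A ∩ B)) (+-cancelʳ-≤ (r P (A ∪ B)) _ _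
    (≤-trans both (+-monoʳ-≤ (x ⟨ A ∩ B ⟩) (x∈P (A ∪ B))))) ,
  ≤-antisym (x∈P (A ∪ B)) (+-cancelˡ-≤ (r P (A ∩ B)) _ _
    (≤-trans both (+-monoˡ-≤ (x ⟨ A ∪ B ⟩) (x∈P (A ∩ B)))))
  where
  both : r P (A ∩ B) + r P (A ∪ B) ≤ x ⟨ A ∩ B ⟩ + x ⟨ A ∪ B ⟩
  both = ≤-trans (submodular P A B)
    (≤-reflexive (trans (sym (cong₂ _+_ tA tB)) (sym (⟨⟩-∩∪ x A B))))

-- Moving a unit from `a` to `b` raises the sum only over sets that contain `b` but not `a`. If none
-- of these is tight, every constraint survives the move.
blocked⇒tight : (P : Polymatroid n) {y : Vec ℕ n} {a b : Fin n} →
  IsBasis P (y ⊕ unit a) → ¬ IsBasis P (y ⊕ unit b) →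
  ∃ λ D → Tight P (y ⊕ unit a) D × b ∈ D × a ∉ D
blocked⇒tight P {y} {a} {b} (x∈P , x⊤) blocked
  with anySubset? (λ D → ((y ⊕ unit a) ⟨ D ⟩ ≟ r P D) ×-dec (b ∈? D) ×-dec ¬? (a ∈? D))
... | yes found = found
... | no  none  = contradiction (x′∈P , x′⊤) blocked
  where
  x′⊤ : (y ⊕ unit b) ⟨ ⊤ ⟩ ≡ Rank P
  x′⊤ = trans (⟨⟩-⊕ y (unit b) ⊤)
    (trans (cong (y ⟨ ⊤ ⟩ +_) (trans (unit⟨⟩-∈ {a = b} ∈⊤) (sym (unit⟨⟩-∈ {a = a} ∈⊤))))
      (trans (sym (⟨⟩-⊕ y (unit a) ⊤)) x⊤))
  x′∈P : (y ⊕ unit b) ∈ᴾ P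
  x′∈P A with b ∈? A | a ∈? A
  ... | no b∉A | _ = ≤-trans (≤-reflexive (trans (⟨⟩-⊕ y (unit b) A)
          (trans (cong (y ⟨ A ⟩ +_) (unit⟨⟩-∉ b∉A)) (+-identityʳ _))))
        (≤-trans (m≤m+n (y ⟨ A ⟩) (unit a ⟨ A ⟩))
          (≤-trans (≤-reflexive (sym (⟨⟩-⊕ y (unit a) A))) (x∈P A)))
  ... | yes b∈A | yes a∈A = ≤-trans (≤-reflexive (trans (⟨⟩-⊕ y (unit b) A)
          (trans (cong (y ⟨ A ⟩ +_) (trans (unit⟨⟩-∈ b∈A) (sym (unit⟨⟩-∈ a∈A))))
            (sym (⟨⟩-⊕ y (unit a) A))))) (x∈P A)
  ... | yes b∈A | no a∉A = ≤-trans (≤-reflexive (trans (⟨⟩-⊕ y (unit b) A)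
          (trans (cong (y ⟨ A ⟩ +_) (unit⟨⟩-∈ b∈A)) (+-comm _ 1))))
        (subst (_< r P A) x≡y (≤∧≢⇒< (x∈P A) (λ tight → none (A , tight , b∈A , a∉A))))
    where
    x≡y : (y ⊕ unit a) ⟨ A ⟩ ≡ y ⟨ A ⟩
    x≡y = trans (⟨⟩-⊕ y (unit a) A) (trans (cong (y ⟨ A ⟩ +_) (unit⟨⟩-∉ a∉A)) (+-identityʳ _))

-- `T` is the union over `b ∈ V` of the intersections over `a ∈ U` of the sets separating `b` from
-- `a`. The empty intersection `⊤` is tight because `x` is a basis, the empty union `⊥` because
-- `r P` is normalized.
tight-separator : (P : Polymatroid n) {x : Vec ℕ n} → IsBasis P x → (U V : Subset n) →
  (∀ {a b} → a ∈ U → b ∈ V → ∃ λ D → Tight P x D × b ∈ D × a ∉ D) →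
  ∃ λ T → Tight P x T × V ⊆ T × (∀ {a} → a ∈ U → a ∉ T)
tight-separator {n} P {x} (x∈P , x⊤) U V separate =
  let (T , tight , V⊆T , avoids) = cover id in T , tight , V⊆T _ , avoids
  where
  -- The function `g` lists the agents already treated, which permits induction on their number; in
  -- the end it is `id`.
  avoid : ∀ {m} (g : Fin m → Fin n) {b} → b ∈ V →
    ∃ λ T → Tight P x T × b ∈ T × (∀ j → g j ∈ U → g j ∉ T)
  avoid {zero}  g b∈V = ⊤ , x⊤ , ∈⊤ , λ ()
  avoid {suc m} g b∈V with avoid (g ∘ suc) b∈V | g zero ∈? U
  ... | T , tight , b∈T , avoids | no g∉U = T , tight , b∈T , λ where
    zero    g∈U → contradiction g∈U g∉U
    (suc j) → avoids j
  ... | T , tight , b∈T , avoids | yes g∈U =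
    let (D , tight′ , b∈D , g∉D) = separate g∈U b∈V
    in D ∩ T , proj₁ (tight-∩∪ P x∈P D T tight′ tight) , x∈p∩q⁺ (b∈D , b∈T) , λ where
      zero    _    ∈∩ → g∉D (proj₁ (x∈p∩q⁻ D T ∈∩))
      (suc j) gj∈U ∈∩ → avoids j gj∈U (proj₂ (x∈p∩q⁻ D T ∈∩))
  cover : ∀ {m} (g : Fin m → Fin n) →
    ∃ λ T → Tight P x T × (∀ j → g j ∈ V → g j ∈ T) × (∀ {a} → a ∈ U → a ∉ T)
  cover {zero}  g = ⊥ , trans (⟨⊥⟩ x) (sym (normalized P)) , (λ ()) , λ _ → ∉⊥
  cover {suc m} g with cover (g ∘ suc) | g zero ∈? V
  ... | T , tight , covers , avoids | no g∉V = T , tight , (λ where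
      zero    g∈V → contradiction g∈V g∉V
      (suc j) → covers j) , avoids
  ... | T , tight , covers , avoids | yes g∈V =
    let (D , tight′ , g∈D , avoids′) = avoid id g∈V
    in D ∪ T , proj₂ (tight-∩∪ P x∈P D T tight′ tight) , (λ where
        zero    _    → x∈p∪q⁺ (inj₁ g∈D)
        (suc j) gj∈V → x∈p∪q⁺ (inj₂ (covers j gj∈V))) ,
       λ a∈U a∈∪ → [ avoids′ _ a∈U , avoids a∈U ]′ (x∈p∪q⁻ D T a∈∪)

-- Levels, and the inequalities between brick-laying and its alternatives

level : ℕ → Vec ℕ n → Subset n
level k v = ⟪ (λ i → k ≤? lookup v i) ⟫

-- An agent outside `U` either ends at height at most `k`, with no excess, or receives nothing and
-- keeps its old excess.
excess-⊕ : ∀ k (ℓ x : Vec ℕ n) (U : Subset n) →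
  (∀ i → k < lookup (ℓ ⊕ x) i → 1 ≤ lookup x i → i ∈ U) →
  excess k (ℓ ⊕ x) ≤ excess k ℓ + x ⟨ U ⟩
excess-⊕ k ℓ x U U⊇ = ⟨⟩-≤-+ (Vec.map (_∸ k) (ℓ ⊕ x)) (Vec.map (_∸ k) ℓ) x ⊤ ⊤ U pointwise
  where
  pointwise : ∀ i → (Vec.map (_∸ k) (ℓ ⊕ x) ↾ ⊤) i ≤ (Vec.map (_∸ k) ℓ ↾ ⊤) i + (x ↾ U) i
  pointwise i rewrite ↾-∈ (Vec.map (_∸ k) (ℓ ⊕ x)) {⊤} {i} ∈⊤ | ↾-∈ (Vec.map (_∸ k) ℓ) {⊤} {i} ∈⊤
    | lookup-map i (_∸ k) (ℓ ⊕ x) | lookup-map i (_∸ k) ℓ with i ∈? U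
  ... | yes i∈U rewrite ↾-∈ x i∈U | lookup-⊕ ℓ x i =
    m≤n+o⇒m∸n≤o _ k (≤-trans (+-monoˡ-≤ (lookup x i) (m≤n+m∸n (lookup ℓ i) k))
      (≤-reflexive (+-assoc k _ _)))
  ... | no i∉U with k <? lookup (ℓ ⊕ x) i | 1 ≤? lookup x i
  ...   | no k≮ | _     = ≤-trans (≤-reflexive (m≤n⇒m∸n≡0 (≮⇒≥ k≮))) z≤n
  ...   | _     | no x≰ = ≤-trans (≤-reflexive (cong (_∸ k) (trans (lookup-⊕ ℓ x i)
            (trans (cong (lookup ℓ i +_) (n<1⇒n≡0 (≰⇒> x≰))) (+-identityʳ _)))))
          (m≤m+n _ _)
  ...   | yes k< | yes 1≤ = contradiction (U⊇ i k< 1≤) i∉U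

-- Units that a majorization-minimal basis lays above height k cannot be moved
-- to agents that end below height k, so some tight set T contains the latter
-- agents and avoids the former units, and every basis z puts at least
-- r ⊤ - r T units outside T.
minimal⇒excess≤ : (P : Polymatroid n) {ℓ x : Vec ℕ n} → IsBasis P x →
  (∀ x′ → IsBasis P x′ → ℓ ⊕ x ⪯ ℓ ⊕ x′) →
  ∀ {z} → IsBasis P z → ∀ k → excess k (ℓ ⊕ x) ≤ excess k ℓ + z ⟨ level k (ℓ ⊕ x) ⟩
minimal⇒excess≤ {n} P {ℓ} {x} x-basis minimal {z} (z∈P , z⊤) k =
  ≤-trans (excess-⊕ k ℓ x U (λ i k< 1≤ → ∈⟪⟫⁺ U? (k< , 1≤))) (+-monoʳ-≤ (excess k ℓ) x≤z)
  where
  U? = λ i → (suc k ≤? lookup (ℓ ⊕ x) i) ×-dec (1 ≤? lookup x i)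
  L? = λ i → k ≤? lookup (ℓ ⊕ x) i
  U L : Subset n
  U = ⟪ U? ⟫
  L = level k (ℓ ⊕ x)

  -- The unit on `a` lies above height `k` and does not count towards `cap k`, whereas on `b` it
  -- would count. So the move would raise `cap k`, against minimality.
  blocked : ∀ {y a b} → y ⊕ unit a ≡ x → k < lookup (ℓ ⊕ x) a → lookup (ℓ ⊕ x) b < k →
    ¬ IsBasis P (y ⊕ unit b)
  blocked {y} {a} {b} refl k< <k basis′ = <-irrefl refl (begin-strict
    cap k (ℓ ⊕ y)            <⟨ n<1+n _ ⟩
    suc (cap k (ℓ ⊕ y))      ≡⟨ cap-⊕-unit-below (ℓ ⊕ y) b (≤-<-trans b≤ <k) ⟨
    cap k (ℓ ⊕ y ⊕ unit b)   ≡⟨ cong (cap k) (⊕-assoc ℓ y (unit b)) ⟩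
    cap k (ℓ ⊕ (y ⊕ unit b)) ≤⟨ ⪯⇒cap≥ (minimal _ basis′) k ⟩
    cap k (ℓ ⊕ (y ⊕ unit a)) ≡⟨ cong (cap k) (⊕-assoc ℓ y (unit a)) ⟨
    cap k (ℓ ⊕ y ⊕ unit a)   ≡⟨ cap-⊕-unit-above (ℓ ⊕ y) a (s≤s⁻¹ (≤-trans k< (≤-reflexive a≡))) ⟩
    cap k (ℓ ⊕ y)            ∎)
    where
    open ≤-Reasoning
    b≤ : lookup (ℓ ⊕ y) b ≤ lookup (ℓ ⊕ (y ⊕ unit a)) b
    b≤ = ≤-trans (m≤m+n _ _) (≤-reflexive (trans (sym (lookup-⊕ (ℓ ⊕ y) (unit a) b))
      (cong (λ v → lookup v b) (⊕-assoc ℓ y (unit a)))))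
    a≡ : lookup (ℓ ⊕ (y ⊕ unit a)) a ≡ suc (lookup (ℓ ⊕ y) a)
    a≡ = trans (cong (λ v → lookup v a) (sym (⊕-assoc ℓ y (unit a))))
      (trans (lookup-⊕ (ℓ ⊕ y) (unit a) a) (trans (cong (lookup (ℓ ⊕ y) a +_) (lookup-unit a)) (+-comm _ 1)))

  separate : ∀ {a b} → a ∈ U → b ∈ ∁ L → ∃ λ D → Tight P x D × b ∈ D × a ∉ D
  separate {a} {b} a∈U b∈∁L with ∈⟪⟫⁻ U? a∈U
  ... | k< , 1≤ with split-unit x a 1≤
  ...   | y , refl = blocked⇒tight P x-basis
    (blocked refl k< (≰⇒> (λ k≤ → x∈∁p⇒x∉p b∈∁L (∈⟪⟫⁺ L? k≤))))

  x≤z : x ⟨ U ⟩ ≤ z ⟨ L ⟩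
  x≤z with tight-separator P x-basis U (∁ L) separate
  ... | T , tight , ∁L⊆T , avoids = begin
    x ⟨ U ⟩   ≤⟨ ⟨⟩-mono-⊆ x (λ a∈U → x∉p⇒x∈∁p (avoids a∈U)) ⟩
    x ⟨ ∁ T ⟩ ≤⟨ outside ⟩
    z ⟨ ∁ T ⟩ ≤⟨ ⟨⟩-mono-⊆ z (λ {i} i∈∁T → decidable-stable (i ∈? L)
                  (λ i∉L → x∈∁p⇒x∉p i∈∁T (∁L⊆T (x∉p⇒x∈∁p i∉L)))) ⟩
    z ⟨ L ⟩   ∎
    where
    open ≤-Reasoning
    outside : x ⟨ ∁ T ⟩ ≤ z ⟨ ∁ T ⟩
    outside = +-cancelˡ-≤ (x ⟨ T ⟩) _ _ (begin
      x ⟨ T ⟩ + x ⟨ ∁ T ⟩ ≡⟨ trans (⟨⟩-∁ x T) (trans (proj₂ x-basis) (trans (sym z⊤) (sym (⟨⟩-∁ z T)))) ⟩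
      z ⟨ T ⟩ + z ⟨ ∁ T ⟩ ≤⟨ +-monoˡ-≤ (z ⟨ ∁ T ⟩) (≤-trans (z∈P T) (≤-reflexive (sym tight))) ⟩
      x ⟨ T ⟩ + z ⟨ ∁ T ⟩ ∎)

-- Hall's condition for splitting z into layers, the (k + 1)-st of which has
-- |level (k + 1) ℓ| units, all given to agents of level k ℓ.
infix 4 _Balances_

_Balances_ : Vec ℕ n → Vec ℕ n → Set
ℓ Balances z = ∀ k → excess k ℓ ≤ z ⟨ level k ℓ ⟩

-- The new excess is paid for by `z`. The old one is paid for by `z₀` on the old level set, which
-- can only have grown.
balances-⊕ : (P : Polymatroid n) {ℓ x : Vec ℕ n} → IsBasis P x →
  (∀ x′ → IsBasis P x′ → ℓ ⊕ x ⪯ ℓ ⊕ x′) →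
  ∀ {z z₀} → IsBasis P z → ℓ Balances z₀ → ℓ ⊕ x Balances z ⊕ z₀
balances-⊕ P {ℓ} {x} x-basis minimal {z} {z₀} z-basis bal k = begin
  excess k (ℓ ⊕ x)           ≤⟨ minimal⇒excess≤ P x-basis minimal z-basis k ⟩
  excess k ℓ + z ⟨ L ⟩       ≤⟨ +-monoˡ-≤ (z ⟨ L ⟩) (≤-trans (bal k) (⟨⟩-mono-⊆ z₀ grow)) ⟩
  z₀ ⟨ L ⟩ + z ⟨ L ⟩         ≡⟨ trans (+-comm (z₀ ⟨ L ⟩) _) (sym (⟨⟩-⊕ z z₀ L)) ⟩
  (z ⊕ z₀) ⟨ L ⟩             ∎
  where
  open ≤-Reasoning
  L = level k (ℓ ⊕ x)
  grow : level k ℓ ⊆ L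
  grow {i} i∈ = ∈⟪⟫⁺ (λ i → k ≤? lookup (ℓ ⊕ x) i) (≤-trans (∈⟪⟫⁻ (λ i → k ≤? lookup ℓ i) i∈)
    (≤-trans (m≤m+n _ _) (≤-reflexive (sym (lookup-⊕ ℓ x i)))))

achievable-total : (h : History n) {z : Vec ℕ n} → z ∈ˡ achievable h → z ⟨ ⊤ ⟩ ≡ totalRank h
achievable-total {n} []        (here refl) = trans (⟨⟩-replicate 0 (⊤ {n})) (*-zeroʳ ∣ ⊤ {n} ∣)
achievable-total ((P , x) ∷ h) z∈ with ∈-cartesianProductWith⁻ _⊕_ (bases P) (achievable h) z∈
... | z₁ , z₂ , z₁∈ , z₂∈ , refl = trans (⟨⟩-⊕ z₁ z₂ ⊤)
  (cong₂ _+_ (proj₂ (Equivalence.to (∈-bases P z₁) z₁∈)) (achievable-total h z₂∈))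

vec-isBasis : {P : Polymatroid n} (x : Basis P) → IsBasis P (vec x)
vec-isBasis {P = P} x = Equivalence.to (∈-bases P (vec x)) (basis-∈ x)

balances-all-[] : ∀ {z} → z ∈ˡ achievable {n} [] → load {n} [] Balances z
balances-all-[] {n} (here refl) k = ≤-trans (≤-reflexive (begin
  excess k (replicate n 0)      ≡⟨ cong (_⟨ ⊤ ⟩) (map-replicate (_∸ k) 0 n) ⟩
  replicate n (0 ∸ k) ⟨ ⊤ ⟩     ≡⟨ ⟨⟩-replicate (0 ∸ k) (⊤ {n}) ⟩
  ∣ ⊤ {n} ∣ * (0 ∸ k)           ≡⟨ cong (∣ ⊤ {n} ∣ *_) (0∸n≡0 k) ⟩
  ∣ ⊤ {n} ∣ * 0                 ≡⟨ *-zeroʳ ∣ ⊤ {n} ∣ ⟩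
  0                             ∎)) z≤n
  where open ≡-Reasoning

balances-all-∷ : {h : History n} {P : Polymatroid n} {x : Basis P} →
  (∀ (x′ : Basis P) → load h ⊕ vec x ⪯ load h ⊕ vec x′) →
  (∀ {z} → z ∈ˡ achievable h → load h Balances z) →
  ∀ {z} → z ∈ˡ achievable ((P , x) ∷ h) → load ((P , x) ∷ h) Balances z
balances-all-∷ {h = h} {P} {x} minimal bal z∈
  with ∈-cartesianProductWith⁻ _⊕_ (bases P) (achievable h) z∈
... | z₁ , z₂ , z₁∈ , z₂∈ , refl = subst (_Balances z₁ ⊕ z₂) (⊕-comm (load h) (vec x))
  (balances-⊕ P (vec-isBasis x) (λ x′ b → minimal (mkBasis x′ b))
    (Equivalence.to (∈-bases P z₁) z₁∈) (bal z₂∈))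

-- Ranking the agents by load

-- Ties between equal entries are broken by the index, so that distinct
-- agents have distinct keys.
key : Vec ℕ n → Fin n → ℕ
key {n} v i = toℕ i + lookup v i * n

key-mono-< : (v : Vec ℕ n) {i j : Fin n} → lookup v i < lookup v j → key v i < key v j
key-mono-< {n} v {i} {j} vi<vj = begin-strict
  toℕ i + lookup v i * n <⟨ +-monoˡ-< (lookup v i * n) (toℕ<n i) ⟩
  suc (lookup v i) * n   ≤⟨ *-monoˡ-≤ n vi<vj ⟩
  lookup v j * n         ≤⟨ m≤n+m _ (toℕ j) ⟩
  toℕ j + lookup v j * n ∎
  where open ≤-Reasoning

-- The index is the remainder of the key modulo the number of agents.
key-injective : (v : Vec ℕ n) → Injective _≡_ _≡_ (key v)
key-injective {suc n} v {i} {j} eq = toℕ-injective (begin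
  toℕ i                 ≡⟨ m<n⇒m%n≡m (toℕ<n i) ⟨
  toℕ i % suc n         ≡⟨ [m+kn]%n≡m%n (toℕ i) (lookup v i) (suc n) ⟨
  key v i % suc n       ≡⟨ cong (_% suc n) eq ⟩
  key v j % suc n       ≡⟨ [m+kn]%n≡m%n (toℕ j) (lookup v j) (suc n) ⟩
  toℕ j % suc n         ≡⟨ m<n⇒m%n≡m (toℕ<n j) ⟩
  toℕ j                 ∎)
  where open ≡-Reasoning

above : Vec ℕ n → Fin n → Subset n
above v i = ⟪ (λ j → key v i <? key v j) ⟫

-- Counted from above: the agent with the largest key has rank 0.
rank : Vec ℕ n → Fin n → ℕ
rank v i = ∣ above v i ∣

infix 4 _Leads_

_Leads_ : Subset n → Vec ℕ n → Set
B Leads v = ∀ {i j} → i ∈ B → j ∉ B → key v j < key v i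

module _ (v : Vec ℕ n) where

  private
    ∈above⁺ : ∀ {i j} → key v i < key v j → j ∈ above v i
    ∈above⁺ {i} = ∈⟪⟫⁺ (λ j → key v i <? key v j)

    ∈above⁻ : ∀ {i j} → j ∈ above v i → key v i < key v j
    ∈above⁻ {i} = ∈⟪⟫⁻ (λ j → key v i <? key v j)

    i∉above : ∀ i → i ∉ above v i
    i∉above i i∈ = <-irrefl refl (∈above⁻ i∈)

  rank-anti-< : ∀ {i j} → key v i < key v j → rank v j < rank v i
  rank-anti-< {i} {j} ki<kj = p⊂q⇒∣p∣<∣q∣
    ((λ l∈ → ∈above⁺ (<-trans ki<kj (∈above⁻ l∈))) , j , ∈above⁺ ki<kj , i∉above j)

  rank<n : ∀ i → rank v i < n
  rank<n i = subst (rank v i <_) (∣⊤∣≡n n) (p⊂q⇒∣p∣<∣q∣ ((λ _ → ∈⊤) , i , ∈⊤ , i∉above i))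

  rank-injective : ∀ {i j} → rank v i ≡ rank v j → i ≡ j
  rank-injective {i} {j} eq with <-cmp (key v i) (key v j)
  ... | tri< lt _ _ = contradiction (sym eq) (<⇒≢ (rank-anti-< lt))
  ... | tri≈ _ k≡ _ = key-injective v k≡
  ... | tri> _ _ gt = contradiction eq (<⇒≢ (rank-anti-< gt))

  top : ℕ → Subset n
  top s = ⟪ (λ i → rank v i <? s) ⟫

  ∈top⁺ : ∀ {s i} → rank v i < s → i ∈ top s
  ∈top⁺ {s} = ∈⟪⟫⁺ (λ i → rank v i <? s)

  ∈top⁻ : ∀ {s i} → i ∈ top s → rank v i < s
  ∈top⁻ {s} = ∈⟪⟫⁻ (λ i → rank v i <? s)

  top-mono : ∀ {s t} → s ≤ t → top s ⊆ top t
  top-mono s≤t i∈ = ∈top⁺ (<-≤-trans (∈top⁻ i∈) s≤t)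

  top-leads : ∀ s → top s Leads v
  top-leads s {i} {j} i∈ j∉ with <-cmp (key v j) (key v i)
  ... | tri< lt _ _ = lt
  ... | tri≈ _ k≡ _ = contradiction (subst (_∈ top s) (sym (key-injective v k≡)) i∈) j∉
  ... | tri> _ _ gt = contradiction (∈top⁺ (<-trans (rank-anti-< gt) (∈top⁻ {s} i∈))) j∉

  -- All agents above a member of `B` are further members, so its rank is less than `∣ B ∣`; all of
  -- `B` is above a nonmember, so its rank is at least `∣ B ∣`.
  leads⇒top : ∀ {B} → B Leads v → B ≡ top ∣ B ∣
  leads⇒top {B} leads = ⊆-antisym
    (λ {i} i∈B → ∈top⁺ (p⊂q⇒∣p∣<∣q∣
      ((λ {j} j∈ → case j ∈? B of λ where
          (yes j∈B) → j∈B
          (no  j∉B) → contradiction (∈above⁻ j∈) (<⇒≯ (leads i∈B j∉B)))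
      , i , i∈B , i∉above i)))
    (λ {i} i∈top → case i ∈? B of λ where
      (yes i∈B) → i∈B
      (no  i∉B) → contradiction (∈top⁻ i∈top)
        (≤⇒≯ (p⊆q⇒∣p∣≤∣q∣ (λ j∈B → ∈above⁺ (leads j∈B i∉B)))))

-- If `j` were missed, punching it out would give an injection into a smaller set.
injective⇒preimage : {f : Fin n → Fin n} → Injective _≡_ _≡_ f → ∀ j → ∃ λ i → f i ≡ j
injective⇒preimage {zero}          _   ()
injective⇒preimage {suc n} {f} inj j with any? (λ i → f i Fin.≟ j)
... | yes found = found
... | no  none  = contradiction
  (λ {i} {i′} eq → inj (punchOut-injective (avoid i) (avoid i′) eq))
  (<⇒notInjective {f = λ i → punchOut (avoid i)} (n<1+n n))
  where
  avoid : ∀ i → j ≢ f i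
  avoid i j≡fi = none (i , sym j≡fi)

injective⇒permutation : (f : Fin n → Fin n) → Injective _≡_ _≡_ f →
  ∃ λ (π : Permutation′ n) → ∀ i → π ⟨$⟩ʳ i ≡ f i
injective⇒permutation f inj = permutation f (proj₁ ∘ pre)
    (λ j → proj₂ (pre j)) (λ i → inj (proj₂ (pre (f i)))) , λ _ → refl
  where pre = injective⇒preimage inj

rankPermutation : (v : Vec ℕ n) → ∃ λ (π : Permutation′ n) → ∀ i → toℕ (π ⟨$⟩ʳ i) ≡ rank v i
rankPermutation v =
  let (π , π≡) = injective⇒permutation (λ i → fromℕ< (rank<n v i)) λ {i} {j} eq → rank-injective v
        (trans (sym (toℕ-fromℕ< (rank<n v i))) (trans (cong toℕ eq) (toℕ-fromℕ< (rank<n v j))))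
  in π , λ i → trans (cong toℕ (π≡ i)) (toℕ-fromℕ< (rank<n v i))

-- The ranking by `v` is composed with the inverse of the ranking by `w`.
matchRanks : (v w : Vec ℕ n) → ∃ λ (π : Permutation′ n) → ∀ i → rank w (π ⟨$⟩ʳ i) ≡ rank v i
matchRanks v w =
  let (ρ , ρ≡) = rankPermutation v
      (σ , σ≡) = rankPermutation w
  in ρ ∘ₚ flip σ , λ i → trans (sym (σ≡ (σ ⟨$⟩ˡ (ρ ⟨$⟩ʳ i)))) (trans (cong toℕ (Perm.inverseʳ σ)) (ρ≡ i))

private
  ones : ℕ → (Fin n → ℕ) → Fin n → ℕ
  ones s f i = if f i <ᵇ s then 1 else 0

  ∣⟪<⟫∣≡sum : (s : ℕ) (f : Fin n → ℕ) → ∣ ⟪ (λ i → f i <? s) ⟫ ∣ ≡ sum (ones s f)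
  ∣⟪<⟫∣≡sum {zero}  s f = refl
  ∣⟪<⟫∣≡sum {suc n} s f with f zero <ᵇ s
  ... | true  = cong suc (∣⟪<⟫∣≡sum s (f ∘ suc))
  ... | false = ∣⟪<⟫∣≡sum s (f ∘ suc)

  sum-ones : ∀ {s} → s ≤ n → sum (ones {n} s toℕ) ≡ s
  sum-ones {zero}  z≤n = refl
  sum-ones {suc n} z≤n = sum-ones {n} z≤n
  sum-ones (s≤s s≤n)   = cong suc (sum-ones s≤n)

-- The ranks are a permutation of the numbers below `n`, of which exactly `s` are less than `s`.
∣top∣≡ : (v : Vec ℕ n) {s : ℕ} → s ≤ n → ∣ top v s ∣ ≡ s
∣top∣≡ {n} v {s} s≤n = let (π , π≡) = rankPermutation v in begin
  ∣ top v s ∣                        ≡⟨ ∣⟪<⟫∣≡sum s (rank v) ⟩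
  sum (ones s (rank v))              ≡⟨ sum-cong-≗ (λ i → cong (λ q → if q <ᵇ s then 1 else 0) (π≡ i)) ⟨
  sum (ones s toℕ ∘ (π ⟨$⟩ʳ_))        ≡⟨ sum-permute (ones s toℕ) π ⟨
  sum (ones {n} s toℕ)               ≡⟨ sum-ones s≤n ⟩
  s                                  ∎
  where open ≡-Reasoning

level-leads : (k : ℕ) (v : Vec ℕ n) → level k v Leads v
level-leads k v i∈ j∉ = key-mono-< v (<-≤-trans
  (≰⇒> (λ k≤ → j∉ (∈⟪⟫⁺ (λ i → k ≤? lookup v i) k≤)))
  (∈⟪⟫⁻ (λ i → k ≤? lookup v i) i∈))

VanishesOff : Subset n → Vec ℕ n → Set
VanishesOff A x = ∀ {i} → i ∉ A → lookup x i ≡ 0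

vanishes-⊆ : {A B : Subset n} {x : Vec ℕ n} → A ⊆ B → VanishesOff A x → VanishesOff B x
vanishes-⊆ A⊆B x0 i∉B = x0 (i∉B ∘ A⊆B)

vanishes⇒⟨⟩≡total : {A : Subset n} {x : Vec ℕ n} → VanishesOff A x → x ⟨ A ⟩ ≡ x ⟨ ⊤ ⟩
vanishes⇒⟨⟩≡total {A = A} {x} x0 = ≤-antisym (⟨⟩-mono-⊆ x {A} (λ _ → ∈⊤)) (⟨⟩-mono x x ⊤ A pointwise)
  where
  pointwise : ∀ i → (x ↾ ⊤) i ≤ (x ↾ A) i
  pointwise i rewrite ↾-∈ x {⊤} {i} ∈⊤ with i ∈? A
  ... | yes i∈A = ≤-reflexive (sym (↾-∈ x i∈A))
  ... | no  i∉A = ≤-trans (≤-reflexive (x0 i∉A)) z≤n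

leads-⊕ : {B : Subset n} {v x : Vec ℕ n} → B Leads v → VanishesOff B x → B Leads x ⊕ v
leads-⊕ {n} {B} {v} {x} leads x0 {i} {j} i∈B j∉B = begin-strict
  key (x ⊕ v) j ≡⟨ cong (λ l → toℕ j + l * n) (trans (lookup-⊕ x v j) (cong (_+ lookup v j) (x0 j∉B))) ⟩
  key v j       <⟨ leads i∈B j∉B ⟩
  key v i       ≤⟨ +-monoʳ-≤ (toℕ i) (*-monoˡ-≤ n vi≤) ⟩
  key (x ⊕ v) i ∎
  where
  open ≤-Reasoning
  vi≤ : lookup v i ≤ lookup (x ⊕ v) i
  vi≤ = ≤-trans (m≤n+m (lookup v i) (lookup x i)) (≤-reflexive (sym (lookup-⊕ x v i)))

-- Units given only to agents of `top v s` lift members of the larger set `top v t`, which therefore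
-- still leads; and a leading set is determined by its size.
top-stable : {v x : Vec ℕ n} {s t : ℕ} → s ≤ t → t ≤ n → VanishesOff (top v s) x →
  top (x ⊕ v) t ≡ top v t
top-stable {v = v} {x} {s} {t} s≤t t≤n x0 = trans
  (cong (top (x ⊕ v)) (sym (∣top∣≡ v t≤n)))
  (sym (leads⇒top (x ⊕ v) (leads-⊕ {v = v} {x} (top-leads v t) (vanishes-⊆ {x = x} (top-mono v s≤t) x0))))

-- If some agent of B has at most k, then so have all agents outside B.
leads⇒average : {A B : Subset n} {v : Vec ℕ n} → B Leads v → B ⊆ A → ∀ k →
  ∣ A ∣ * k + ∣ B ∣ ≤ v ⟨ A ⟩ → ∣ B ∣ * suc k ≤ v ⟨ B ⟩
leads⇒average {n} {A} {B} {v} leads B⊆A k le with any? (λ i → (i ∈? B) ×-dec (lookup v i ≤? k))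
... | no none = ≤-trans (≤-reflexive (sym (⟨⟩-replicate (suc k) B)))
    (⟨⟩-mono (replicate n (suc k)) v B B pointwise)
  where
  pointwise : ∀ i → (replicate n (suc k) ↾ B) i ≤ (v ↾ B) i
  pointwise i with i ∈? B
  ... | yes i∈B rewrite ↾-∈ (replicate n (suc k)) i∈B | ↾-∈ v i∈B | lookup-replicate i (suc k) =
    ≰⇒> (λ vi≤k → none (i , i∈B , vi≤k))
  ... | no i∉B = ≤-trans (≤-reflexive (↾-∉ (replicate n (suc k)) i∉B)) z≤n
... | yes (i , i∈B , vi≤k) = +-cancelʳ-≤ (∣ A ∣ * k) _ _ (begin
    ∣ B ∣ * suc k + ∣ A ∣ * k           ≡⟨ regroup ∣ A ∣ ∣ B ∣ k ⟩
    (∣ A ∣ * k + ∣ B ∣) + ∣ B ∣ * k     ≤⟨ +-monoˡ-≤ (∣ B ∣ * k) le ⟩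
    v ⟨ A ⟩ + ∣ B ∣ * k                 ≡⟨ cong (v ⟨ A ⟩ +_) (⟨⟩-replicate k B) ⟨
    -- Each agent of `A` outside `B` holds at most `k`, which bounds the difference of `v ⟨ A ⟩` and
    -- `v ⟨ B ⟩`.
    v ⟨ A ⟩ + replicate n k ⟨ B ⟩       ≤⟨ ⟨⟩-+-mono v (replicate n k) v (replicate n k) A B B A pointwise ⟩
    v ⟨ B ⟩ + replicate n k ⟨ A ⟩       ≡⟨ cong (v ⟨ B ⟩ +_) (⟨⟩-replicate k A) ⟩
    v ⟨ B ⟩ + ∣ A ∣ * k                 ∎)
  where
  open ≤-Reasoning
  regroup : ∀ a b k → b * suc k + a * k ≡ (a * k + b) + b * k
  regroup = solve-∀
  low : ∀ {j} → j ∉ B → lookup v j ≤ k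
  low j∉B = ≮⇒≥ (λ k<vj → <⇒≯ (leads i∈B j∉B) (key-mono-< v (≤-<-trans vi≤k k<vj)))
  pointwise : ∀ j → (v ↾ A) j + (replicate n k ↾ B) j ≤ (v ↾ B) j + (replicate n k ↾ A) j
  pointwise j with j ∈? B | j ∈? A
  ... | yes j∈B | _ rewrite ↾-∈ v j∈B | ↾-∈ v (B⊆A j∈B)
      | ↾-∈ (replicate n k) j∈B | ↾-∈ (replicate n k) (B⊆A j∈B) = ≤-refl
  ... | no j∉B | yes j∈A rewrite ↾-∉ v j∉B | ↾-∈ v j∈A
      | ↾-∉ (replicate n k) j∉B | ↾-∈ (replicate n k) j∈A | lookup-replicate j k =
    ≤-trans (≤-reflexive (+-identityʳ _)) (low j∉B)
  ... | no j∉B | no j∉A rewrite ↾-∉ v j∉A | ↾-∉ (replicate n k) j∉B = z≤n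

-- The layer adversary

module _ (S : Subset n) (q : ℕ) where

  private
    when : {X : Set} → Dec X → ℕ
    when d = if does d then q else 0

    when-mono : {X Y : Set} (d : Dec X) (e : Dec Y) → (X → Y) → when d ≤ when e
    when-mono (no _)  _       _ = z≤n
    when-mono (yes _) (yes _) _ = ≤-refl
    when-mono (yes x) (no ¬y) f = contradiction (f x) ¬y

    meets? : (A : Subset n) → Dec (Nonempty (A ∩ S))
    meets? A = nonempty? (A ∩ S)

    meets-map : {A B : Subset n} → A ⊆ B → Nonempty (A ∩ S) → Nonempty (B ∩ S)
    meets-map {A} A⊆B (i , i∈) = let (i∈A , i∈S) = x∈p∩q⁻ A S i∈ in i , x∈p∩q⁺ (A⊆B i∈A , i∈S)

    meets-∪ : (A B : Subset n) → Nonempty ((A ∪ B) ∩ S) → Nonempty (A ∩ S) ⊎ Nonempty (B ∩ S)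
    meets-∪ A B (i , i∈) with x∈p∩q⁻ (A ∪ B) S i∈
    ... | i∈∪ , i∈S = Sum.map (λ i∈A → i , x∈p∩q⁺ (i∈A , i∈S)) (λ i∈B → i , x∈p∩q⁺ (i∈B , i∈S))
      (x∈p∪q⁻ A B i∈∪)

    -- If one of the two sets misses `S`, so does the intersection, and the union meets `S` only if
    -- the other set does. If both meet `S`, each term on the right is `q`.
    when-submodular : ∀ A B →
      when (meets? (A ∩ B)) + when (meets? (A ∪ B)) ≤ when (meets? A) + when (meets? B)
    when-submodular A B = helper (meets? A) (meets? B)
      where
      ∩⇒A : Nonempty ((A ∩ B) ∩ S) → Nonempty (A ∩ S)
      ∩⇒A = meets-map (proj₁ ∘ x∈p∩q⁻ A B)
      ∩⇒B : Nonempty ((A ∩ B) ∩ S) → Nonempty (B ∩ S)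
      ∩⇒B = meets-map (proj₂ ∘ x∈p∩q⁻ A B)
      helper : (a : Dec (Nonempty (A ∩ S))) (b : Dec (Nonempty (B ∩ S))) →
        when (meets? (A ∩ B)) + when (meets? (A ∪ B)) ≤ when a + when b
      helper (no ¬a) b = +-mono-≤ (when-mono (meets? (A ∩ B)) (no ¬a) ∩⇒A)
        (when-mono (meets? (A ∪ B)) b ([ (λ a → contradiction a ¬a) , id ]′ ∘ meets-∪ A B))
      helper a (no ¬b) = ≤-trans (+-mono-≤ (when-mono (meets? (A ∩ B)) (no ¬b) ∩⇒B)
        (when-mono (meets? (A ∪ B)) a ([ id , (λ b → contradiction b ¬b) ]′ ∘ meets-∪ A B)))
        (≤-reflexive (+-comm 0 (when a)))
      helper (yes a) (yes b) = +-mono-≤ (when-mono (meets? (A ∩ B)) (yes a) ∩⇒A)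
        (when-mono (meets? (A ∪ B)) (yes b) (λ _ → b))

  -- q units to be distributed freely over the agents of S
  spread : Polymatroid n
  spread .r A = when (meets? A)
  spread .normalized with meets? ⊥
  ... | yes (i , i∈) = contradiction (proj₁ (x∈p∩q⁻ ⊥ S i∈)) ∉⊥
  ... | no _         = refl
  spread .monotone A B A⊆B = when-mono (meets? A) (meets? B) (meets-map A⊆B)
  spread .submodular = when-submodular

  spread-rank : q ≤ ∣ S ∣ → Rank spread ≡ q
  spread-rank q≤ with nonempty? (⊤ ∩ S)
  ... | yes _ = refl
  -- Here `S` is empty, so `q ≤ ∣ S ∣` forces `q` to be 0.
  ... | no empty = sym (n≤0⇒n≡0 (≤-trans q≤ (≤-trans (p⊆q⇒∣p∣≤∣q∣ {q = ⊥}
          (λ i∈S → contradiction (_ , x∈p∩q⁺ (∈⊤ , i∈S)) empty)) (≤-reflexive (∣⊥∣≡0 n)))))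

  -- The complement of `S` misses `S` and hence has rank 0.
  spread-vanishes : {x : Vec ℕ n} → x ∈ᴾ spread → VanishesOff S x
  spread-vanishes {x} x∈ {i} i∉S = n≤0⇒n≡0 (≤-trans (lookup≤⟨⟩ x (x∉p⇒x∈∁p i∉S))
    (≤-trans (x∈ (∁ S)) r∁≤0))
    where
    lookup≤⟨⟩ : ∀ {n} (x : Vec ℕ n) {i A} → i ∈ A → lookup x i ≤ x ⟨ A ⟩
    lookup≤⟨⟩ (l ∷ x) Vec.here                  = m≤m+n l _
    lookup≤⟨⟩ (l ∷ x) {A = s ∷ _} (Vec.there i∈) = ≤-trans (lookup≤⟨⟩ x i∈) (m≤n+m _ _)
    r∁≤0 : r spread (∁ S) ≤ 0
    r∁≤0 with nonempty? (∁ S ∩ S)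
    ... | yes (j , j∈) = contradiction (proj₂ (x∈p∩q⁻ (∁ S) S j∈))
      (x∈∁p⇒x∉p (proj₁ (x∈p∩q⁻ (∁ S) S j∈)))
    ... | no _         = z≤n

  spread-∈ : {x : Vec ℕ n} → VanishesOff S x → x ⟨ ⊤ ⟩ ≡ q → x ∈ᴾ spread
  spread-∈ {x} x0 x⊤ A with nonempty? (A ∩ S)
  ... | yes _ = ≤-trans (⟨⟩-mono-⊆ x {A} (λ _ → ∈⊤)) (≤-reflexive x⊤)
  ... | no empty = ≤-trans (⟨⟩-mono x x A ⊥ pointwise) (≤-reflexive (⟨⊥⟩ x))
    where
    pointwise : ∀ i → (x ↾ A) i ≤ (x ↾ ⊥) i
    pointwise i with i ∈? A
    ... | no i∉A = ≤-trans (≤-reflexive (↾-∉ x i∉A)) z≤n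
    ... | yes i∈A = ≤-trans (≤-reflexive (trans (↾-∈ x i∈A)
      (x0 (λ i∈S → empty (i , x∈p∩q⁺ (i∈A , i∈S)))))) z≤n

-- Greedily: each agent of `S` in turn yields as many units as it has or as are still wanted.
extract : (v : Vec ℕ n) (S : Subset n) {q : ℕ} → q ≤ v ⟨ S ⟩ →
  ∃ λ z → ∃ λ w → z ⊕ w ≡ v × VanishesOff S z × z ⟨ ⊤ ⟩ ≡ q
extract []      []          z≤n = [] , [] , refl , (λ { {()} }) , refl
extract (l ∷ v) (false ∷ S) q≤ =
  let (z , w , eq , z0 , z⊤) = extract v S q≤
  in 0 ∷ z , l ∷ w , cong (l ∷_) eq
   , (λ { {zero} _ → refl ; {suc i} i∉ → z0 (i∉ ∘ Vec.there) }) , z⊤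
extract {suc n} (l ∷ v) (true ∷ S) {q} q≤ with ≤-total q l
... | inj₁ q≤l = q ∷ replicate n 0 , (l ∸ q) ∷ v
  , cong₂ _∷_ (m+[n∸m]≡n q≤l) (trans (⊕-comm (replicate n 0) v) (⊕-identityʳ v))
  , (λ { {zero} i∉ → contradiction Vec.here i∉ ; {suc i} i∉ → lookup-replicate i 0 })
  , trans (cong (q +_) (trans (⟨⟩-replicate 0 (⊤ {n})) (*-zeroʳ ∣ ⊤ {n} ∣))) (+-identityʳ q)
... | inj₂ l≤q =
  let (z , w , eq , z0 , z⊤) = extract v S (m≤n+o⇒m∸n≤o q l q≤)
  in l ∷ z , 0 ∷ w , cong₂ _∷_ (+-identityʳ l) eq
   , (λ { {zero} i∉ → contradiction Vec.here i∉ ; {suc i} i∉ → z0 (i∉ ∘ Vec.there) })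
   , trans (cong (l +_) z⊤) (m+[n∸m]≡n l≤q)

-- Layers of a vector and relabelling of agents

total≡0⇒replicate : (v : Vec ℕ n) → v ⟨ ⊤ ⟩ ≡ 0 → v ≡ replicate n 0
total≡0⇒replicate []      _  = refl
total≡0⇒replicate (l ∷ v) eq = cong₂ _∷_ (m+n≡0⇒m≡0 l eq) (total≡0⇒replicate v (m+n≡0⇒n≡0 l eq))

excess-anti : ∀ {k l} (v : Vec ℕ n) → k ≤ l → excess l v ≤ excess k v
excess-anti []      k≤l = z≤n
excess-anti (x ∷ v) k≤l = +-mono-≤ (∸-monoʳ-≤ x k≤l) (excess-anti v k≤l)

excess-0 : (v : Vec ℕ n) → excess 0 v ≡ v ⟨ ⊤ ⟩
excess-0 []      = refl
excess-0 (x ∷ v) = cong (x +_) (excess-0 v)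

excess-total : (v : Vec ℕ n) → excess (v ⟨ ⊤ ⟩) v ≡ 0
excess-total v = n≤0⇒n≡0 (go v ≤-refl)
  where
  go : ∀ {n k} (v : Vec ℕ n) → v ⟨ ⊤ ⟩ ≤ k → excess k v ≤ 0
  go         []      _  = z≤n
  go {k = k} (x ∷ v) le = +-mono-≤
    (≤-reflexive (m≤n⇒m∸n≡0 (≤-trans (m≤m+n x (v ⟨ ⊤ ⟩)) le)))
    (go v (≤-trans (m≤n+m (v ⟨ ⊤ ⟩) x) le))

excess-suc : ∀ k (v : Vec ℕ n) → excess k v ≡ ∣ level (suc k) v ∣ + excess (suc k) v
excess-suc k []      = refl
-- This is the Boolean to which the membership test of `level (suc k)` computes.
excess-suc k (x ∷ v) with k <ᵇ x in eq
... | true = trans (cong₂ _+_ (+-∸-assoc 1 k<x) (excess-suc k v))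
    (regroup (x ∸ suc k) ∣ level (suc k) v ∣ (excess (suc k) v))
  where
  k<x : k < x
  k<x = <ᵇ⇒< k x (subst T (sym eq) _)
  regroup : ∀ a b c → suc a + (b + c) ≡ suc b + (a + c)
  regroup = solve-∀
... | false = trans (cong₂ _+_ (m≤n⇒m∸n≡0 x≤k) (excess-suc k v))
    (cong (λ q → ∣ level (suc k) v ∣ + (q + excess (suc k) v)) (sym (m≤n⇒m∸n≡0 (m≤n⇒m≤1+n x≤k))))
  where
  x≤k : x ≤ k
  x≤k = ≮⇒≥ (λ k<x → subst T eq (<⇒<ᵇ k<x))

level-anti : ∀ {k l} (v : Vec ℕ n) → k ≤ l → level l v ⊆ level k v
level-anti {k = k} {l} v k≤l i∈ = ∈⟪⟫⁺ (λ i → k ≤? lookup v i)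
  (≤-trans k≤l (∈⟪⟫⁻ (λ i → l ≤? lookup v i) i∈))

-- Bound `min(vᵢ, c)` by `c` on `S` and by `vᵢ` off `S`, then add `v ⟨ S ⟩` to both sides to avoid
-- subtraction.
cap-split : ∀ c (v : Vec ℕ n) (S : Subset n) → cap c v + v ⟨ S ⟩ ≤ ∣ S ∣ * c + v ⟨ ⊤ ⟩
cap-split {n} c v S = subst (λ a → cap c v + v ⟨ S ⟩ ≤ a + v ⟨ ⊤ ⟩) (⟨⟩-replicate c S)
  (⟨⟩-+-mono (Vec.map (_⊓ c) v) v (replicate n c) v ⊤ S S ⊤ pointwise)
  where
  pointwise : ∀ i → (Vec.map (_⊓ c) v ↾ ⊤) i + (v ↾ S) i ≤ (replicate n c ↾ S) i + (v ↾ ⊤) i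
  pointwise i rewrite ↾-∈ (Vec.map (_⊓ c) v) {⊤} {i} ∈⊤ | ↾-∈ v {⊤} {i} ∈⊤ | lookup-map i (_⊓ c) v
    with i ∈? S
  ... | yes i∈S rewrite ↾-∈ v i∈S | ↾-∈ (replicate n c) i∈S | lookup-replicate i c =
    +-monoˡ-≤ (lookup v i) (m⊓n≤n _ c)
  ... | no i∉S rewrite ↾-∉ v i∉S | ↾-∉ (replicate n c) i∉S =
    ≤-trans (≤-reflexive (+-identityʳ _)) (m⊓n≤m _ c)

relabel : (Fin n → Fin n) → Vec ℕ n → Vec ℕ n
relabel f v = tabulate (λ i → lookup v (f i))

module _ (π : Permutation′ n) (v : Vec ℕ n) where

  relabel-⟨⟩ : (A B : Subset n) → (∀ i → lookup B i ≡ lookup A (π ⟨$⟩ʳ i)) →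
    relabel (π ⟨$⟩ʳ_) v ⟨ B ⟩ ≡ v ⟨ A ⟩
  relabel-⟨⟩ A B eq = begin
    relabel (π ⟨$⟩ʳ_) v ⟨ B ⟩        ≡⟨ ⟨⟩≡sum _ B ⟩
    sum (relabel (π ⟨$⟩ʳ_) v ↾ B)    ≡⟨ sum-cong-≗ (λ i → cong₂ (if_then_else 0) (eq i) (lookup∘tabulate _ i)) ⟩
    sum (λ i → (v ↾ A) (π ⟨$⟩ʳ i))   ≡⟨ sum-permute (v ↾ A) π ⟨
    sum (v ↾ A)                      ≡⟨ ⟨⟩≡sum v A ⟨
    v ⟨ A ⟩                          ∎
    where open ≡-Reasoning

  relabel-total : relabel (π ⟨$⟩ʳ_) v ⟨ ⊤ ⟩ ≡ v ⟨ ⊤ ⟩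
  relabel-total = relabel-⟨⟩ ⊤ ⊤ (λ i → trans (lookup-replicate i true) (sym (lookup-replicate (π ⟨$⟩ʳ i) true)))

relabel-⪯ : (π : Permutation′ n) (v : Vec ℕ n) → relabel (π ⟨$⟩ʳ_) v ⪯ v
relabel-⪯ π v = cap≥⇒⪯ (relabel-total π v) λ c → ≤-reflexive (begin
  cap c v                                         ≡⟨ relabel-total π (Vec.map (_⊓ c) v) ⟨
  relabel (π ⟨$⟩ʳ_) (Vec.map (_⊓ c) v) ⟨ ⊤ ⟩      ≡⟨ cong (_⟨ ⊤ ⟩) (tabulate-cong (λ i → lookup-map (π ⟨$⟩ʳ i) (_⊓ c) v)) ⟩
  tabulate (λ i → lookup v (π ⟨$⟩ʳ i) ⊓ c) ⟨ ⊤ ⟩  ≡⟨ cong (_⟨ ⊤ ⟩) (tabulate-∘ (_⊓ c) (λ i → lookup v (π ⟨$⟩ʳ i))) ⟩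
  cap c (relabel (π ⟨$⟩ʳ_) v)                     ∎)
  where open ≡-Reasoning

relabel-top : (v w : Vec ℕ n) (π : Permutation′ n) → (∀ i → rank w (π ⟨$⟩ʳ i) ≡ rank v i) →
  ∀ z s → relabel (π ⟨$⟩ʳ_) z ⟨ top v s ⟩ ≡ z ⟨ top w s ⟩
relabel-top v w π π≡ z s = relabel-⟨⟩ π z (top w s) (top v s) λ i → begin
  lookup (top v s) i            ≡⟨ lookup∘tabulate (λ j → rank v j <ᵇ s) i ⟩
  (rank v i <ᵇ s)               ≡⟨ cong (_<ᵇ s) (π≡ i) ⟨
  (rank w (π ⟨$⟩ʳ i) <ᵇ s)      ≡⟨ lookup∘tabulate (λ j → rank w j <ᵇ s) (π ⟨$⟩ʳ i) ⟨
  lookup (top w s) (π ⟨$⟩ʳ i)   ∎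
  where open ≡-Reasoning

-- In round k + 1 the adversary presents the s (k + 1) units of the (k + 1)-st
-- layer of L, to be distributed freely over the s k most loaded agents.
module Layers {n m : ℕ} (L : Vec ℕ n) (total : L ⟨ ⊤ ⟩ ≡ m) where

  s E : ℕ → ℕ
  s k = ∣ level k L ∣
  E k = excess k L

  s≤n : ∀ k → s k ≤ n
  s≤n k = ∣p∣≤n (level k L)

  s-anti : ∀ {k l} → k ≤ l → s l ≤ s k
  s-anti k≤l = p⊆q⇒∣p∣≤∣q∣ (level-anti L k≤l)

  B : ℕ → Vec ℕ n → Subset n
  B c ℓ = top ℓ (s c)

  ∣B∣≡ : ∀ c ℓ → ∣ B c ℓ ∣ ≡ s c
  ∣B∣≡ c ℓ = ∣top∣≡ ℓ (s≤n c)

  present : History n → Polymatroid n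
  present h = spread (B (length h) (load h)) (s (suc (length h)))

  present-rank : ∀ h → Rank (present h) ≡ s (suc (length h))
  present-rank h = spread-rank (B (length h) (load h)) _
    (≤-trans (s-anti (n≤1+n (length h))) (≤-reflexive (sym (∣B∣≡ (length h) (load h)))))

  rank-step : ∀ h x → totalRank h + E (length h) ≡ m →
    totalRank ((present h , x) ∷ h) + E (suc (length h)) ≡ m
  rank-step h x eq = begin
    Rank (present h) + totalRank h + E (suc k) ≡⟨ cong (λ q → q + totalRank h + E (suc k)) (present-rank h) ⟩
    s (suc k) + totalRank h + E (suc k)        ≡⟨ regroup (s (suc k)) (totalRank h) (E (suc k)) ⟩
    totalRank h + (s (suc k) + E (suc k))      ≡⟨ cong (totalRank h +_) (excess-suc k L) ⟨
    totalRank h + E k                          ≡⟨ eq ⟩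
    m                                          ∎
    where
    open ≡-Reasoning
    k = length h
    regroup : ∀ a b c → a + b + c ≡ b + (a + c)
    regroup = solve-∀

  adversary : Adversary n m
  adversary .Adversary.next = present
  adversary .Adversary.ends = go m [] refl (trans (excess-0 L) total)
    where
    -- At most `m` rounds are needed: no entry of `L` exceeds its total `m`, so `E m` is 0 and a
    -- history of length `m` has total rank `m`.
    go : ∀ fuel h → length h + fuel ≡ m → totalRank h + E (length h) ≡ m → Ends present m h
    go fuel h eq inv with totalRank h ≟ m
    ... | yes finished = done finished
    go zero h eq inv | no unfinished = contradiction (begin
      totalRank h                 ≡⟨ +-identityʳ _ ⟨
      totalRank h + 0             ≡⟨ cong (totalRank h +_) (excess-total L) ⟨
      totalRank h + E (L ⟨ ⊤ ⟩)   ≡⟨ cong (λ k → totalRank h + E k) (trans total (trans (sym eq) (+-identityʳ _))) ⟩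
      totalRank h + E (length h)  ≡⟨ inv ⟩
      m                           ∎) unfinished
      where open ≡-Reasoning
    go (suc fuel) h eq inv | no unfinished = step unfinished λ x →
      go fuel ((present h , x) ∷ h) (trans (sym (+-suc (length h) fuel)) eq) (rank-step h x inv)

  -- E (length h) is the number of units in the layers not yet presented.
  record Invariant (h : History n) : Set where
    field
      ranks : totalRank h + E (length h) ≡ m
      -- With `k = length h`, the number `s c * c + E c - E k` is what the agents of `level c L`
      -- hold in the first `k` layers of `L`.
      loads : ∀ c → c ≤ length h → s c * c + E c ≤ load h ⟨ B c (load h) ⟩ + E (length h)
      -- This is Hall's condition for the layers presented so far: the `E c - E (length h)` units of
      -- the layers after the first `c` are all confined to `B c (load h)`.
      reach : ∀ w → w ⟨ ⊤ ⟩ + E (length h) ≡ m →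
        (∀ c → c ≤ length h → E c ≤ w ⟨ B c (load h) ⟩ + E (length h)) → w ∈ˡ achievable h

  open Invariant

  invariant-[] : Invariant []
  invariant-[] .ranks = trans (excess-0 L) total
  invariant-[] .loads zero _ = ≤-trans (≤-reflexive (cong (_+ E 0) (*-zeroʳ (s 0)))) (m≤n+m (E 0) _)
  invariant-[] .reach w w⊤ _ = here (total≡0⇒replicate w
    (+-cancelʳ-≡ (E 0) _ _ (trans w⊤ (sym (trans (excess-0 L) total)))))

  module Step (h : History n) (x : Basis (present h)) (inv : Invariant h) where

    k : ℕ
    k = length h

    ℓ ℓ′ y : Vec ℕ n
    y  = vec x
    ℓ  = load h
    ℓ′ = y ⊕ ℓ

    basis : IsBasis (present h) y
    basis = vec-isBasis x

    y0 : VanishesOff (B k ℓ) y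
    y0 = spread-vanishes (B k ℓ) (s (suc k)) {y} (proj₁ basis)

    -- The new units go to `B k ℓ`, which is contained in `B c ℓ`.
    stable : ∀ {c} → c ≤ k → B c ℓ′ ≡ B c ℓ
    stable {c} c≤k = top-stable {v = ℓ} {y} (s-anti c≤k) (s≤n c) y0

    vanishes-total : ∀ {c z} → c ≤ k → VanishesOff (B k ℓ) z → z ⟨ ⊤ ⟩ ≡ s (suc k) →
      z ⟨ B c ℓ ⟩ ≡ s (suc k)
    vanishes-total {c} {z} c≤k z0 z⊤ = trans
      (vanishes⇒⟨⟩≡total {A = B c ℓ} {z} (vanishes-⊆ {x = z} (top-mono ℓ (s-anti c≤k)) z0)) z⊤

    loads-old : ∀ c → c ≤ k → s c * c + E c ≤ ℓ′ ⟨ B c ℓ′ ⟩ + E (suc k)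
    loads-old c c≤k = begin
      s c * c + E c                           ≤⟨ inv .loads c c≤k ⟩
      ℓ ⟨ B c ℓ ⟩ + E k                       ≡⟨ cong (ℓ ⟨ B c ℓ ⟩ +_) (excess-suc k L) ⟩
      ℓ ⟨ B c ℓ ⟩ + (s (suc k) + E (suc k))   ≡⟨ regroup (ℓ ⟨ B c ℓ ⟩) (s (suc k)) (E (suc k)) ⟩
      s (suc k) + ℓ ⟨ B c ℓ ⟩ + E (suc k)     ≡⟨ cong (λ q → q + ℓ ⟨ B c ℓ ⟩ + E (suc k))
                                                   (vanishes-total {c} {y} c≤k y0 (trans (proj₂ basis) (present-rank h))) ⟨
      y ⟨ B c ℓ ⟩ + ℓ ⟨ B c ℓ ⟩ + E (suc k)   ≡⟨ cong (_+ E (suc k)) (⟨⟩-⊕ y ℓ (B c ℓ)) ⟨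
      ℓ′ ⟨ B c ℓ ⟩ + E (suc k)                ≡⟨ cong (λ A → ℓ′ ⟨ A ⟩ + E (suc k)) (stable c≤k) ⟨
      ℓ′ ⟨ B c ℓ′ ⟩ + E (suc k)               ∎
      where
      open ≤-Reasoning
      regroup : ∀ a b c → a + (b + c) ≡ b + a + c
      regroup = solve-∀

    -- By `loads-old` at `c = k`, the set `B k ℓ′` holds `k` units per agent and `s (suc k)` more;
    -- averaging passes this on to its most loaded part `B (suc k) ℓ′`.
    loads-new : s (suc k) * suc k + E (suc k) ≤ ℓ′ ⟨ B (suc k) ℓ′ ⟩ + E (suc k)
    loads-new = +-monoˡ-≤ (E (suc k)) (subst (λ q → q * suc k ≤ ℓ′ ⟨ B (suc k) ℓ′ ⟩) (∣B∣≡ (suc k) ℓ′)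
      (leads⇒average {v = ℓ′} (top-leads ℓ′ (s (suc k))) (top-mono ℓ′ (s-anti (n≤1+n k))) k average))
      where
      open ≤-Reasoning
      average : ∣ B k ℓ′ ∣ * k + ∣ B (suc k) ℓ′ ∣ ≤ ℓ′ ⟨ B k ℓ′ ⟩
      average = +-cancelʳ-≤ (E (suc k)) _ _ (begin
        ∣ B k ℓ′ ∣ * k + ∣ B (suc k) ℓ′ ∣ + E (suc k) ≡⟨ cong₂ (λ p q → p * k + q + E (suc k))
                                                           (∣B∣≡ k ℓ′) (∣B∣≡ (suc k) ℓ′) ⟩
        s k * k + s (suc k) + E (suc k)               ≡⟨ +-assoc (s k * k) _ _ ⟩
        s k * k + (s (suc k) + E (suc k))             ≡⟨ cong (s k * k +_) (excess-suc k L) ⟨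
        s k * k + E k                                 ≤⟨ loads-old k ≤-refl ⟩
        ℓ′ ⟨ B k ℓ′ ⟩ + E (suc k)                     ∎)

    -- For `c ≤ k` all `s (suc k)` units of `z` lie in `B c ℓ`. Removing `z` thus lowers the sum by
    -- exactly the difference of `E k` and `E (suc k)`, and Hall's condition for the earlier rounds
    -- remains.
    reach-⊕ : ∀ z u → VanishesOff (B k ℓ) z → z ⟨ ⊤ ⟩ ≡ s (suc k) →
      (z ⊕ u) ⟨ ⊤ ⟩ + E (suc k) ≡ m →
      (∀ c → c ≤ suc k → E c ≤ (z ⊕ u) ⟨ B c ℓ′ ⟩ + E (suc k)) →
      z ⊕ u ∈ˡ achievable ((present h , x) ∷ h)
    reach-⊕ z u z0 z⊤ w⊤ hall = ∈-cartesianProductWith⁺ _⊕_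
      (Equivalence.from (∈-bases (present h) z)
        (spread-∈ (B k ℓ) (s (suc k)) {z} z0 z⊤ , trans z⊤ (sym (present-rank h))))
      (inv .reach u u⊤ hall′)
      where
      move : ∀ A → z ⟨ A ⟩ ≡ s (suc k) → (z ⊕ u) ⟨ A ⟩ + E (suc k) ≡ u ⟨ A ⟩ + E k
      move A zA = begin
        (z ⊕ u) ⟨ A ⟩ + E (suc k)              ≡⟨ cong (_+ E (suc k)) (trans (⟨⟩-⊕ z u A) (cong (_+ u ⟨ A ⟩) zA)) ⟩
        s (suc k) + u ⟨ A ⟩ + E (suc k)        ≡⟨ regroup (s (suc k)) (u ⟨ A ⟩) (E (suc k)) ⟩
        u ⟨ A ⟩ + (s (suc k) + E (suc k))      ≡⟨ cong (u ⟨ A ⟩ +_) (excess-suc k L) ⟨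
        u ⟨ A ⟩ + E k                          ∎
        where
        open ≡-Reasoning
        regroup : ∀ a b c → a + b + c ≡ b + (a + c)
        regroup = solve-∀
      u⊤ : u ⟨ ⊤ ⟩ + E k ≡ m
      u⊤ = trans (sym (move ⊤ z⊤)) w⊤
      hall′ : ∀ c → c ≤ k → E c ≤ u ⟨ B c ℓ ⟩ + E k
      hall′ c c≤k = ≤-trans (hall c (m≤n⇒m≤1+n c≤k)) (≤-reflexive (trans
        (cong (λ A → (z ⊕ u) ⟨ A ⟩ + E (suc k)) (stable c≤k))
        (move (B c ℓ) (vanishes-total {c} {z} c≤k z0 z⊤))))

    reach-step : ∀ w → w ⟨ ⊤ ⟩ + E (suc k) ≡ m →
      (∀ c → c ≤ suc k → E c ≤ w ⟨ B c ℓ′ ⟩ + E (suc k)) →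
      w ∈ˡ achievable ((present h , x) ∷ h)
    reach-step w w⊤ hall =
      let (z , u , z⊕u≡w , z0 , z⊤) = extract w (B k ℓ) layer≤
      in subst (_∈ˡ achievable ((present h , x) ∷ h)) z⊕u≡w (reach-⊕ z u z0 z⊤
           (subst (λ v → v ⟨ ⊤ ⟩ + E (suc k) ≡ m) (sym z⊕u≡w) w⊤)
           (λ c c≤ → subst (λ v → E c ≤ v ⟨ B c ℓ′ ⟩ + E (suc k)) (sym z⊕u≡w) (hall c c≤)))
      where
      -- Hall's condition at `c = k` provides the units of the last layer. Any choice of them will
      -- do, as `B k ℓ` lies in all the earlier sets.
      layer≤ : s (suc k) ≤ w ⟨ B k ℓ ⟩
      layer≤ = +-cancelʳ-≤ (E (suc k)) _ _ (subst₂ _≤_ (excess-suc k L)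
        (cong (λ A → w ⟨ A ⟩ + E (suc k)) (stable ≤-refl)) (hall k (n≤1+n k)))

    invariant-∷ : Invariant ((present h , x) ∷ h)
    invariant-∷ .ranks = rank-step h x (inv .ranks)
    invariant-∷ .loads c c≤ with m≤n⇒m<n∨m≡n c≤
    ... | inj₁ c<  = loads-old c (s≤s⁻¹ c<)
    ... | inj₂ refl = loads-new
    invariant-∷ .reach = reach-step

  open Step public using (invariant-∷)

  module Final (h : History n) (inv : Invariant h) (finished : totalRank h ≡ m) where

    open ≤-Reasoning

    E≡0 : E (length h) ≡ 0
    E≡0 = +-cancelˡ-≡ m _ _ (trans (cong (_+ E (length h)) (sym finished))
      (trans (inv .ranks) (sym (+-identityʳ m))))

    load-total : load h ⟨ ⊤ ⟩ ≡ m
    load-total = trans (achievable-total h (load∈achievable h)) finished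

    -- Beyond the last layer `E c` is 0. Otherwise `B c (load h)` holds at least `s c * c + E c`
    -- units but contributes at most `s c * c` to the cap, so `E c` units of the total `m` are lost.
    cap+E≤ : ∀ c → cap c (load h) + E c ≤ m
    cap+E≤ c with ≤-total c (length h)
    ... | inj₂ k≤c = begin
      cap c (load h) + E c                    ≤⟨ +-monoʳ-≤ (cap c (load h)) (≤-trans (excess-anti L k≤c)
                                                   (≤-trans (≤-reflexive E≡0) z≤n)) ⟩
      cap c (load h) + excess c (load h)      ≡⟨ trans (cap+excess c (load h)) load-total ⟩
      m                                       ∎
    ... | inj₁ c≤k = +-cancelʳ-≤ (s c * c) _ _ (begin
      cap c (load h) + E c + s c * c          ≡⟨ trans (+-assoc (cap c (load h)) (E c) _)
                                                   (cong (cap c (load h) +_) (+-comm (E c) _)) ⟩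
      cap c (load h) + (s c * c + E c)        ≤⟨ +-monoʳ-≤ (cap c (load h)) (≤-trans (inv .loads c c≤k)
                                                   (≤-reflexive (trans (cong (load h ⟨ B c (load h) ⟩ +_) E≡0)
                                                     (+-identityʳ _)))) ⟩
      cap c (load h) + load h ⟨ B c (load h) ⟩ ≤⟨ cap-split c (load h) (B c (load h)) ⟩
      ∣ B c (load h) ∣ * c + load h ⟨ ⊤ ⟩     ≡⟨ cong₂ (λ q t → q * c + t) (∣B∣≡ c (load h)) load-total ⟩
      s c * c + m                             ≡⟨ +-comm (s c * c) m ⟩
      m + s c * c                             ∎)

    L⪯load : L ⪯ load h
    L⪯load = cap≥⇒⪯ (trans total (sym load-total)) λ c → +-cancelʳ-≤ (E c) (cap c (load h)) (cap c L)
      (≤-trans (cap+E≤ c) (≤-reflexive (trans (sym total) (sym (cap+excess c L)))))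

    -- Matching ranks carries `B c (load h)` to the top `s c` agents of `L`, that is, to
    -- `level c L`. So the balance of `z` becomes Hall's condition for `w`.
    relabelled-achievable : ∀ {z} → z ⟨ ⊤ ⟩ ≡ m → L Balances z →
      ∃ λ w → w ∈ˡ achievable h × w ⪯ z
    relabelled-achievable {z} z⊤ bal = w , inv .reach w
        (trans (cong₂ _+_ (trans (relabel-total π z) z⊤) E≡0) (+-identityʳ m)) hall
      , relabel-⪯ π z
      where
      π = proj₁ (matchRanks (load h) L)
      w = relabel (π ⟨$⟩ʳ_) z
      hall : ∀ c → c ≤ length h → E c ≤ w ⟨ B c (load h) ⟩ + E (length h)
      hall c _ = begin
        E c                                  ≤⟨ bal c ⟩
        z ⟨ level c L ⟩                      ≡⟨ cong (z ⟨_⟩) (leads⇒top L (level-leads c L)) ⟩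
        z ⟨ top L (s c) ⟩                    ≡⟨ relabel-top (load h) L π (proj₂ (matchRanks (load h) L)) z (s c) ⟨
        w ⟨ B c (load h) ⟩                   ≤⟨ m≤m+n _ _ ⟩
        w ⟨ B c (load h) ⟩ + E (length h)    ∎

-- Real arithmetic

private
  0≤ : {p q : ℚ} → 0ℚ ℚ.≤ p → 0ℚ ℚ.≤ q → 0ℚ ℚ.≤ p ℚ.* q
  0≤ {p} {q} 0≤p 0≤q = ℚ.nonNegative⁻¹ (p ℚ.* q)
    {{ℚ.nonNeg*nonNeg⇒nonNeg p {{ℚ.nonNegative 0≤p}} q {{ℚ.nonNegative 0≤q}}}}

  0≤-+ : {p q : ℚ} → 0ℚ ℚ.≤ p → 0ℚ ℚ.≤ q → 0ℚ ℚ.≤ p ℚ.+ q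
  0≤-+ = ℚ.+-mono-≤

  p≤q⇒0≤q-p : {p q : ℚ} → p ℚ.≤ q → 0ℚ ℚ.≤ q ℚ.- p
  p≤q⇒0≤q-p {p} {q} p≤q = subst (ℚ._≤ q ℚ.- p) (ℚ.+-inverseʳ p) (ℚ.+-monoˡ-≤ (ℚ.- p) p≤q)

  p≤p+ε : (p : ℚ) {ε : ℚ} → 0ℚ ℚ.< ε → p ℚ.≤ p ℚ.+ ε
  p≤p+ε p {ε} 0<ε = subst (ℚ._≤ p ℚ.+ ε) (ℚ.+-identityʳ p) (ℚ.+-monoʳ-≤ p (ℚ.<⇒≤ 0<ε))

  ½-pos : {ε : ℚ} → 0ℚ ℚ.< ε → 0ℚ ℚ.< ε ℚ.* ½
  ½-pos {ε} 0<ε = subst (ℚ._< ε ℚ.* ½) (ℚ.*-zeroˡ ½) (ℚ.*-monoˡ-<-pos ½ 0<ε)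

  ½+½ : ∀ ε → ε ℚ.* ½ ℚ.+ ε ℚ.* ½ ≡ ε
  ½+½ ε = trans (sym (ℚ.*-distribˡ-+ ε ½ ½)) (ℚ.*-identityʳ ε)

≗⇒≤ᴿ : (x y : ℝ) → (∀ n → seq x n ≡ seq y n) → x ≤ᴿ y
≗⇒≤ᴿ x y eq = mk≤ λ ε 0<ε → 0 , λ n _ →
  ℚ.≤-trans (ℚ.≤-reflexive (eq n)) (p≤p+ε (seq y n) 0<ε)

+ᴿ-mono-≤ : ∀ {a b c d} → a ≤ᴿ b → c ≤ᴿ d → a +ᴿ c ≤ᴿ b +ᴿ d
+ᴿ-mono-≤ {a} {b} {c} {d} a≤b c≤d = mk≤ λ ε 0<ε →
  let (N , p) = within a≤b (ε ℚ.* ½) (½-pos 0<ε)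
      (M , q) = within c≤d (ε ℚ.* ½) (½-pos 0<ε)
  in N ℕ.⊔ M , λ n le → ℚ.≤-trans
    (ℚ.+-mono-≤ (p n (ℕ.m⊔n≤o⇒m≤o N M le)) (q n (ℕ.m⊔n≤o⇒n≤o N M le)))
    (ℚ.≤-reflexive (trans (regroup (seq b n) (seq d n) (ε ℚ.* ½))
      (cong (seq b n ℚ.+ seq d n ℚ.+_) (½+½ ε))))
  where
  open +-*-Solver
  regroup : ∀ b d h → (b ℚ.+ h) ℚ.+ (d ℚ.+ h) ≡ (b ℚ.+ d) ℚ.+ (h ℚ.+ h)
  regroup = solve 3 (λ b d h → (b :+ h) :+ (d :+ h) := (b :+ d) :+ (h :+ h)) refl

+ᴿ-nonNeg : ∀ {x y} → 0ᴿ ≤ᴿ x → 0ᴿ ≤ᴿ y → 0ᴿ ≤ᴿ x +ᴿ y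
+ᴿ-nonNeg {x} {y} 0≤x 0≤y = ≤ᴿ-trans (≗⇒≤ᴿ 0ᴿ (0ᴿ +ᴿ 0ᴿ) λ _ → refl)
  (+ᴿ-mono-≤ {0ᴿ} {x} {0ᴿ} {y} 0≤x 0≤y)

-- With its converse below, this reduces inequalities to nonnegative differences, to which ring
-- identities of rationals apply termwise.
x≤y⇒0≤y-x : ∀ {x y} → x ≤ᴿ y → 0ᴿ ≤ᴿ y -ᴿ x
x≤y⇒0≤y-x {x} {y} x≤y = ≤ᴿ-trans
  (≗⇒≤ᴿ 0ᴿ (x -ᴿ x) λ n → sym (ℚ.+-inverseʳ (seq x n)))
  (+ᴿ-mono-≤ x≤y ≤ᴿ-refl)

0≤y-x⇒x≤y : ∀ {x y} → 0ᴿ ≤ᴿ y -ᴿ x → x ≤ᴿ y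
0≤y-x⇒x≤y {x} {y} 0≤ = ≤ᴿ-trans
  (≗⇒≤ᴿ x (0ᴿ +ᴿ x) λ n → sym (ℚ.+-identityˡ (seq x n)))
  (≤ᴿ-trans (+ᴿ-mono-≤ 0≤ ≤ᴿ-refl) (≗⇒≤ᴿ (y -ᴿ x +ᴿ x) y λ n → lemma (seq x n) (seq y n)))
  where
  open +-*-Solver
  lemma : ∀ p q → (q ℚ.- p) ℚ.+ p ≡ q
  lemma = solve 2 (λ p q → (q :+ :- p) :+ p := q) refl

-ᴿ-anti-≤ : ∀ {x y} → x ≤ᴿ y → -ᴿ y ≤ᴿ -ᴿ x
-ᴿ-anti-≤ {x} {y} x≤y = 0≤y-x⇒x≤y (≤ᴿ-trans (x≤y⇒0≤y-x x≤y)
  (≗⇒≤ᴿ (y -ᴿ x) ((-ᴿ x) -ᴿ (-ᴿ y)) λ n → lemma (seq x n) (seq y n)))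
  where
  open +-*-Solver
  lemma : ∀ p q → q ℚ.- p ≡ (ℚ.- p) ℚ.- (ℚ.- q)
  lemma = solve 2 (λ p q → q :+ :- p := :- p :+ :- (:- q)) refl

eventually-bounded : ∀ x → ∃ λ b → 0ℚ ℚ.≤ b × ∃ λ N → ∀ n → N ℕ.≤ n → ℚ.∣ seq x n ∣ ℚ.≤ b
eventually-bounded (mkℝ x cauchy) with cauchy 1ℚ (ℚ.positive⁻¹ 1ℚ)
... | N , close = ℚ.∣ x N ∣ ℚ.+ 1ℚ
  , ℚ.+-mono-≤ (ℚ.0≤∣p∣ (x N)) (ℚ.<⇒≤ (ℚ.positive⁻¹ 1ℚ))
  , N , λ n N≤n → ℚ.≤-trans
      (ℚ.≤-reflexive (cong ℚ.∣_∣ (lemma (x N) (x n))))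
      (ℚ.≤-trans (ℚ.∣p+q∣≤∣p∣+∣q∣ (x N) (x n ℚ.- x N))
        (ℚ.+-monoʳ-≤ ℚ.∣ x N ∣ (close n N N≤n ℕ.≤-refl)))
  where
  open +-*-Solver
  lemma : ∀ p q → q ≡ p ℚ.+ (q ℚ.- p)
  lemma = solve 2 (λ p q → q := p :+ (q :+ :- p)) refl

private
  p≤∣p∣ : ∀ p → p ℚ.≤ ℚ.∣ p ∣
  p≤∣p∣ p with ℚ.≤-total 0ℚ p
  ... | inj₁ 0≤p = ℚ.≤-reflexive (sym (ℚ.0≤p⇒∣p∣≡p 0≤p))
  ... | inj₂ p≤0 = ℚ.≤-trans p≤0 (ℚ.0≤∣p∣ p)

  -- The factors may be as low as `-δ`. Depending on the sign of `q`, the sum of `p * q` and `δ * c`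
  -- or `δ * b` is at least a sum of two products of nonnegative factors.
  product-≥ : ∀ {p q b c δ ε} → 0ℚ ℚ.≤ δ → 0ℚ ℚ.≤ b → δ ℚ.* b ℚ.≤ ε → δ ℚ.* c ℚ.≤ ε →
    p ℚ.≤ b → q ℚ.≤ c → 0ℚ ℚ.≤ p ℚ.+ δ → 0ℚ ℚ.≤ q ℚ.+ δ → 0ℚ ℚ.≤ p ℚ.* q ℚ.+ ε
  product-≥ {p} {q} {b} {c} {δ} {ε} 0≤δ 0≤b δb≤ε δc≤ε p≤b q≤c 0≤p+δ 0≤q+δ with ℚ.≤-total 0ℚ q
  ... | inj₁ 0≤q = ℚ.≤-trans
    (0≤-+ (0≤ 0≤p+δ 0≤q) (0≤ 0≤δ (p≤q⇒0≤q-p q≤c)))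
    (ℚ.≤-trans (ℚ.≤-reflexive (identity p q c δ)) (ℚ.+-monoʳ-≤ (p ℚ.* q) δc≤ε))
    where
    open +-*-Solver
    identity : ∀ p q c δ → (p ℚ.+ δ) ℚ.* q ℚ.+ δ ℚ.* (c ℚ.- q) ≡ p ℚ.* q ℚ.+ δ ℚ.* c
    identity = solve 4 (λ p q c δ → (p :+ δ) :* q :+ δ :* (c :+ :- q) := p :* q :+ δ :* c) refl
  ... | inj₂ q≤0 = ℚ.≤-trans
    (0≤-+ (0≤ (p≤q⇒0≤q-p p≤b) (ℚ.neg-antimono-≤ q≤0)) (0≤ 0≤b 0≤q+δ))
    (ℚ.≤-trans (ℚ.≤-reflexive (identity p q b δ)) (ℚ.+-monoʳ-≤ (p ℚ.* q) δb≤ε))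
    where
    open +-*-Solver
    identity : ∀ p q b δ → (b ℚ.- p) ℚ.* (ℚ.- q) ℚ.+ b ℚ.* (q ℚ.+ δ) ≡ p ℚ.* q ℚ.+ δ ℚ.* b
    identity = solve 4 (λ p q b δ → (b :+ :- p) :* (:- q) :+ b :* (q :+ δ) := p :* q :+ δ :* b) refl

  small-multiple : ∀ {ε b c} → 0ℚ ℚ.< ε → 0ℚ ℚ.≤ b → 0ℚ ℚ.≤ c →
    ∃ λ δ → 0ℚ ℚ.< δ × δ ℚ.* b ℚ.≤ ε × δ ℚ.* c ℚ.≤ ε
  small-multiple {ε} {b} {c} 0<ε 0≤b 0≤c = δ , 0<δ ,
    δ*≤ b (subst (ℚ._≤ b ℚ.+ c) (ℚ.+-identityʳ b) (ℚ.+-monoʳ-≤ b 0≤c)) ,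
    δ*≤ c (subst (ℚ._≤ b ℚ.+ c) (ℚ.+-identityˡ c) (ℚ.+-monoˡ-≤ c 0≤b))
    where
    -- The added 1 keeps the divisor positive when `b` and `c` vanish.
    D = 1ℚ ℚ.+ (b ℚ.+ c)
    0<D : 0ℚ ℚ.< D
    0<D = ℚ.+-mono-<-≤ {0ℚ} {1ℚ} {0ℚ} {b ℚ.+ c} (ℚ.positive⁻¹ 1ℚ) (0≤-+ {b} {c} 0≤b 0≤c)
    instance
      D-pos : ℚ.Positive D
      D-pos = ℚ.positive 0<D
      D-nonZero : ℚ.NonZero D
      D-nonZero = ℚ.pos⇒nonZero D
      1/D-pos : ℚ.Positive (ℚ.1/ D)
      1/D-pos = ℚ.1/pos⇒pos D
    δ = ε ℚ.* ℚ.1/ D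
    0<δ : 0ℚ ℚ.< δ
    0<δ = subst (ℚ._< δ) (ℚ.*-zeroˡ (ℚ.1/ D)) (ℚ.*-monoˡ-<-pos (ℚ.1/ D) 0<ε)
    δ*D≡ε : δ ℚ.* D ≡ ε
    δ*D≡ε = trans (ℚ.*-assoc ε (ℚ.1/ D) D) (trans (cong (ε ℚ.*_) (ℚ.*-inverseˡ D)) (ℚ.*-identityʳ ε))
    b+c≤D : b ℚ.+ c ℚ.≤ D
    b+c≤D = subst (ℚ._≤ D) (ℚ.+-identityˡ (b ℚ.+ c)) (ℚ.+-monoˡ-≤ (b ℚ.+ c) (ℚ.<⇒≤ (ℚ.positive⁻¹ 1ℚ)))
    δ*≤ : ∀ r → r ℚ.≤ b ℚ.+ c → δ ℚ.* r ℚ.≤ ε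
    δ*≤ r r≤ = ℚ.≤-trans (ℚ.*-monoˡ-≤-nonNeg δ {{ℚ.nonNegative (ℚ.<⇒≤ 0<δ)}} (ℚ.≤-trans r≤ b+c≤D))
      (ℚ.≤-reflexive δ*D≡ε)

*ᴿ-nonNeg : ∀ {x y} → 0ᴿ ≤ᴿ x → 0ᴿ ≤ᴿ y → 0ᴿ ≤ᴿ x *ᴿ y
*ᴿ-nonNeg {x} {y} 0≤x 0≤y = mk≤ λ ε 0<ε →
  let (b , 0≤b , N₁ , x≤b) = eventually-bounded x
      (c , 0≤c , N₂ , y≤c) = eventually-bounded y
      (δ , 0<δ , δb≤ε , δc≤ε) = small-multiple 0<ε 0≤b 0≤c
      (N₃ , x≥) = within 0≤x δ 0<δ
      (N₄ , y≥) = within 0≤y δ 0<δ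
  in (N₁ ℕ.⊔ N₂) ℕ.⊔ (N₃ ℕ.⊔ N₄) , λ n le →
  let le₁ = ℕ.m⊔n≤o⇒m≤o (N₁ ℕ.⊔ N₂) (N₃ ℕ.⊔ N₄) le
      le₂ = ℕ.m⊔n≤o⇒n≤o (N₁ ℕ.⊔ N₂) (N₃ ℕ.⊔ N₄) le
  in product-≥ {seq x n} {seq y n} {b} {c} {δ} {ε} (ℚ.<⇒≤ 0<δ) 0≤b δb≤ε δc≤ε
    (ℚ.≤-trans (p≤∣p∣ (seq x n)) (x≤b n (ℕ.m⊔n≤o⇒m≤o N₁ N₂ le₁)))
    (ℚ.≤-trans (p≤∣p∣ (seq y n)) (y≤c n (ℕ.m⊔n≤o⇒n≤o N₁ N₂ le₁)))
    (x≥ n (ℕ.m⊔n≤o⇒m≤o N₃ N₄ le₂)) (y≥ n (ℕ.m⊔n≤o⇒n≤o N₃ N₄ le₂))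

*ᴿ-monoˡ-≤ : ∀ {p x y} → 0ᴿ ≤ᴿ p → x ≤ᴿ y → p *ᴿ x ≤ᴿ p *ᴿ y
*ᴿ-monoˡ-≤ {p} {x} {y} 0≤p x≤y = 0≤y-x⇒x≤y (≤ᴿ-trans (*ᴿ-nonNeg 0≤p (x≤y⇒0≤y-x x≤y))
  (≗⇒≤ᴿ (p *ᴿ (y -ᴿ x)) (p *ᴿ y -ᴿ p *ᴿ x) λ n → lemma (seq p n) (seq x n) (seq y n)))
  where
  open +-*-Solver
  lemma : ∀ p x y → p ℚ.* (y ℚ.- x) ≡ p ℚ.* y ℚ.- p ℚ.* x
  lemma = solve 3 (λ p x y → p :* (y :+ :- x) := p :* y :+ :- (p :* x)) refl

-- s v - v = (s - 1) (v + b) + (1 - s) b, with b a bound of |v|.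
≈1⇒≤-*ᴿ : ∀ {s} v → s ≈ᴿ 1ᴿ → v ≤ᴿ s *ᴿ v
≈1⇒≤-*ᴿ {s} v (s≤1 , 1≤s) = let (b , 0≤b , N , v≤b) = eventually-bounded v in bounded b 0≤b N v≤b
  where
  open +-*-Solver
  identity : ∀ s v b → (s ℚ.- 1ℚ) ℚ.* (v ℚ.+ b) ℚ.+ (1ℚ ℚ.- s) ℚ.* b ≡ s ℚ.* v ℚ.- v
  identity = solve 3 (λ s v b →
    (s :+ :- con 1ℚ) :* (v :+ b) :+ (con 1ℚ :+ :- s) :* b := s :* v :+ :- v) refl
  0≤p+b : ∀ p b → ℚ.∣ p ∣ ℚ.≤ b → 0ℚ ℚ.≤ p ℚ.+ b
  0≤p+b p b le = subst (ℚ._≤ p ℚ.+ b) (ℚ.+-inverseʳ p) (ℚ.+-monoʳ-≤ p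
    (ℚ.≤-trans (p≤∣p∣ (ℚ.- p)) (ℚ.≤-trans (ℚ.≤-reflexive (ℚ.∣-p∣≡∣p∣ p)) le)))
  bounded : ∀ b → 0ℚ ℚ.≤ b → ∀ N → (∀ n → N ℕ.≤ n → ℚ.∣ seq v n ∣ ℚ.≤ b) → v ≤ᴿ s *ᴿ v
  bounded b 0≤b N v≤b = 0≤y-x⇒x≤y (≤ᴿ-trans
    (+ᴿ-nonNeg (*ᴿ-nonNeg (x≤y⇒0≤y-x 1≤s) 0≤v+b) (*ᴿ-nonNeg (x≤y⇒0≤y-x s≤1) 0≤bᴿ))
    (≗⇒≤ᴿ ((s -ᴿ 1ᴿ) *ᴿ (v +ᴿ fromℚ b) +ᴿ (1ᴿ -ᴿ s) *ᴿ fromℚ b) (s *ᴿ v -ᴿ v)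
      λ n → identity (seq s n) (seq v n) b))
    where
    0≤v+b : 0ᴿ ≤ᴿ v +ᴿ fromℚ b
    0≤v+b = mk≤ λ ε 0<ε → N , λ n N≤n → ℚ.≤-trans (0≤p+b (seq v n) b (v≤b n N≤n)) (p≤p+ε (seq v n ℚ.+ b) 0<ε)
    0≤bᴿ : 0ᴿ ≤ᴿ fromℚ b
    0≤bᴿ = mk≤ λ ε 0<ε → 0 , λ n _ → ℚ.≤-trans 0≤b (p≤p+ε b 0<ε)

-- The weights add up to 1 only up to `_≈ᴿ_`, so `v` is first compared with the sum of the weights
-- times `v`, then term by term.
𝔼-≥ : {A : Set} (d : Distribution A) {φ : A → ℝ} {v : ℝ} → (∀ a → v ≤ᴿ φ a) → v ≤ᴿ 𝔼 d φ
𝔼-≥ d {φ} {v} v≤φ = ≤ᴿ-trans (≈1⇒≤-*ᴿ v (total d)) (weighted (support d) (nonneg d))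
  where
  weighted : ∀ ps → All (λ (p , _) → 0ᴿ ≤ᴿ p) ps →
    sumᴿ (List.map proj₁ ps) *ᴿ v ≤ᴿ sumᴿ (List.map (λ (p , a) → p *ᴿ φ a) ps)
  weighted [] [] = ≗⇒≤ᴿ (0ᴿ *ᴿ v) 0ᴿ λ n → ℚ.*-zeroˡ (seq v n)
  weighted ((p , a) ∷ ps) (0≤p ∷ 0≤ps) = ≤ᴿ-trans
    (≗⇒≤ᴿ ((p +ᴿ sumᴿ (List.map proj₁ ps)) *ᴿ v) (p *ᴿ v +ᴿ sumᴿ (List.map proj₁ ps) *ᴿ v)
      λ n → ℚ.*-distribʳ-+ (seq v n) (seq p n) _)
    (+ᴿ-mono-≤ (*ᴿ-monoˡ-≤ 0≤p (v≤φ a)) (weighted ps 0≤ps))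

𝔼-dirac-≤ : {A : Set} (a : A) (φ : A → ℝ) → 𝔼 (dirac a) φ ≤ᴿ φ a
𝔼-dirac-≤ a φ = ≗⇒≤ᴿ (1ᴿ *ᴿ φ a +ᴿ 0ᴿ) (φ a) λ n →
  trans (ℚ.+-identityʳ _) (ℚ.*-identityˡ (seq (φ a) n))

module _ {α : ℝ} (0<α : 0ᴿ <ᴿ α) where

  private
    eventually-nonNeg : ∃ λ N → ∀ n → N ℕ.≤ n → 0ℚ ℚ.≤ seq α n
    eventually-nonNeg = let (ε , 0<ε , N , ε≤) = 0<α in
      N , λ n N≤n → ℚ.≤-trans (ℚ.<⇒≤ 0<ε) (ℚ.≤-trans (ℚ.≤-reflexive (sym (ℚ.+-identityˡ ε))) (ε≤ n N≤n))

    eventually-≗⇒≤ᴿ : ∀ {x y} N → (∀ n → N ℕ.≤ n → seq x n ≡ seq y n) → x ≤ᴿ y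
    eventually-≗⇒≤ᴿ {y = y} N eq = mk≤ λ ε 0<ε → N , λ n N≤n →
      ℚ.≤-trans (ℚ.≤-reflexive (eq n N≤n)) (p≤p+ε (seq y n) 0<ε)

  0≤α : 0ᴿ ≤ᴿ α
  0≤α = mk≤ λ ε 0<ε → let (N , 0≤) = eventually-nonNeg in
    N , λ n N≤n → ℚ.≤-trans (0≤ n N≤n) (p≤p+ε _ 0<ε)

  -- Multiplication distributes over the maximum at the indices where `seq α` is nonnegative, which
  -- is eventually the case.
  *ᴿ-⊔-lub : ∀ {x y u} → α *ᴿ x ≤ᴿ u → α *ᴿ y ≤ᴿ u → α *ᴿ (x ⊔ᴿ y) ≤ᴿ u
  *ᴿ-⊔-lub {x} {y} αx≤u αy≤u = let (N , 0≤) = eventually-nonNeg in ≤ᴿ-trans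
    (eventually-≗⇒≤ᴿ {α *ᴿ (x ⊔ᴿ y)} {α *ᴿ x ⊔ᴿ α *ᴿ y} N λ n N≤n →
      ℚ.*-distribˡ-⊔-nonNeg (seq α n) {{ℚ.nonNegative (0≤ n N≤n)}} (seq x n) (seq y n))
    (⊔ᴿ-lub αx≤u αy≤u)

  *ᴿ-⊓-glb : ∀ {x y u} → u ≤ᴿ α *ᴿ x → u ≤ᴿ α *ᴿ y → u ≤ᴿ α *ᴿ (x ⊓ᴿ y)
  *ᴿ-⊓-glb {x} {y} u≤αx u≤αy = let (N , 0≤) = eventually-nonNeg in ≤ᴿ-trans
    (⊓ᴿ-glb u≤αx u≤αy)
    (eventually-≗⇒≤ᴿ {α *ᴿ x ⊓ᴿ α *ᴿ y} {α *ᴿ (x ⊓ᴿ y)} N λ n N≤n →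
      sym (ℚ.*-distribˡ-⊓-nonNeg (seq α n) {{ℚ.nonNegative (0≤ n N≤n)}} (seq x n) (seq y n)))

  *ᴿ-maximum-≤ : {A : Set} (φ : A → ℝ) {xs : List A} {x : A} (x∈xs : x ∈ˡ xs) {u : ℝ} →
    (∀ {y} → y ∈ˡ xs → α *ᴿ φ y ≤ᴿ u) → α *ᴿ maximum φ x∈xs ≤ᴿ u
  *ᴿ-maximum-≤ φ {xs} {x} x∈xs {u} le = go xs le
    where
    go : ∀ ys → (∀ {y} → y ∈ˡ ys → α *ᴿ φ y ≤ᴿ u) → α *ᴿ foldr _⊔ᴿ_ (φ x) (List.map φ ys) ≤ᴿ u
    -- The starting value of the fold is `φ x`, with `x` itself in the list.
    go []       _  = le x∈xs
    go (y ∷ ys) le = *ᴿ-⊔-lub (le (here refl)) (go ys (le ∘ there))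

  ≤-*ᴿ-minimum : {A : Set} (φ : A → ℝ) {xs : List A} {x : A} (x∈xs : x ∈ˡ xs) {u : ℝ} →
    (∀ {y} → y ∈ˡ xs → u ≤ᴿ α *ᴿ φ y) → u ≤ᴿ α *ᴿ minimum φ x∈xs
  ≤-*ᴿ-minimum φ {xs} {x} x∈xs {u} le = go xs le
    where
    go : ∀ ys → (∀ {y} → y ∈ˡ ys → u ≤ᴿ α *ᴿ φ y) → u ≤ᴿ α *ᴿ foldr _⊓ᴿ_ (φ x) (List.map φ ys)
    go []       _  = le x∈xs
    go (y ∷ ys) le = *ᴿ-⊓-glb (le (here refl)) (go ys (le ∘ there))

x-y≤z⇒x≤z+y : ∀ {x y z} → x -ᴿ y ≤ᴿ z → x ≤ᴿ z +ᴿ y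
x-y≤z⇒x≤z+y {x} {y} {z} le = ≤ᴿ-trans
  (≗⇒≤ᴿ x (x -ᴿ y +ᴿ y) λ n → lemma (seq x n) (seq y n)) (+ᴿ-mono-≤ le ≤ᴿ-refl)
  where
  open +-*-Solver
  lemma : ∀ x y → x ≡ (x ℚ.- y) ℚ.+ y
  lemma = solve 2 (λ x y → x := (x :+ :- y) :+ y) refl

x≤z+y⇒x-y≤z : ∀ {x y z} → x ≤ᴿ z +ᴿ y → x -ᴿ y ≤ᴿ z
x≤z+y⇒x-y≤z {x} {y} {z} le = ≤ᴿ-trans (+ᴿ-mono-≤ le (≤ᴿ-refl { -ᴿ y }))
  (≗⇒≤ᴿ (z +ᴿ y -ᴿ y) z λ n → lemma (seq z n) (seq y n))
  where
  open +-*-Solver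
  lemma : ∀ z y → (z ℚ.+ y) ℚ.- y ≡ z
  lemma = solve 2 (λ z y → (z :+ y) :+ :- y := z) refl

-- Regret

module _ {n m : ℕ} {φ : History n → ℝ} {u : ℝ} {next : History n → Polymatroid n}
         (Inv : History n → Set) where

  -- The invariant survives every basis, whatever is drawn, so the bound holds in each final history
  -- and thus on average.
  expectedFrom-≥ : (A : Allocation n) →
    (∀ h x → Inv h → Inv ((next h , x) ∷ h)) →
    (∀ h → Inv h → totalRank h ≡ m → u ≤ᴿ φ h) →
    ∀ {h} (e : Ends next m h) → Inv h → u ≤ᴿ expectedFrom A φ next e
  expectedFrom-≥ A preserved final (done eq)      inv = final _ inv eq
  expectedFrom-≥ A preserved final {h} (step _ k) inv = 𝔼-≥ (A h (next h)) λ x →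
    expectedFrom-≥ A preserved final (k x) (preserved h x inv)

  expectedFrom-≤ : (D : DeterministicAllocation n) →
    (∀ h → Inv h → Inv ((next h , D h (next h)) ∷ h)) →
    (∀ h → Inv h → totalRank h ≡ m → φ h ≤ᴿ u) →
    ∀ {h} (e : Ends next m h) → Inv h → expectedFrom (deterministic D) φ next e ≤ᴿ u
  expectedFrom-≤ D preserved final (done eq)      inv = final _ inv eq
  expectedFrom-≤ D preserved final {h} (step _ k) inv = ≤ᴿ-trans
    (𝔼-dirac-≤ (D h (next h)) (λ x → expectedFrom (deterministic D) φ next (k x)))
    (expectedFrom-≤ D preserved final (k (D h (next h))) (preserved h inv))

-- ψ z ℓ is the cost of the load ℓ against the alternative z, and φ the cost
-- against the best alternative.
brickLaying-optimal : {n m : ℕ} (φ : History n → ℝ) (ψ : Vec ℕ n → Vec ℕ n → ℝ) →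
  (∀ {z w ℓ ℓ′} → w ⪯ z → ℓ ⪯ ℓ′ → ψ z ℓ ≤ᴿ ψ w ℓ′) →
  (∀ h {z} → z ∈ˡ achievable h → ψ z (load h) ≤ᴿ φ h) →
  (∀ h {u} → (∀ {z} → z ∈ˡ achievable h → ψ z (load h) ≤ᴿ u) → φ h ≤ᴿ u) →
  (BL : DeterministicAllocation n) → IsBrickLaying BL → (A : Allocation n) →
  sup {Adversary n m} (λ P → expected (deterministic BL) P φ) ≤ᵁ
  sup {Adversary n m} (λ P → expected A P φ)
brickLaying-optimal {n} {m} φ ψ ψ-mono ψ≤φ φ-least BL isBL A u bound P =
  expectedFrom-≤ (λ h → ∀ {z} → z ∈ˡ achievable h → load h Balances z) BL
    (λ h bal → balances-all-∷ {h = h} {next P h} {BL h (next P h)} (isBL h (next P h)) bal)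
    (λ h bal finished → φ-least h λ z∈ → against h bal finished z∈)
    (ends P) balances-all-[]
  where
  -- Let `A` play against the layer adversary of `load h`. In each final history the cost is at
  -- least `ψ z (load h)`, hence so is the expected cost, which `u` bounds.
  against : ∀ h → (∀ {z} → z ∈ˡ achievable h → load h Balances z) → totalRank h ≡ m →
    ∀ {z} → z ∈ˡ achievable h → ψ z (load h) ≤ᴿ u
  against h bal finished {z} z∈ = ≤ᴿ-trans
    (expectedFrom-≥ Invariant A (λ h′ x inv → invariant-∷ h′ x inv)
      (λ h′ inv finished′ →
        let (w , w∈ , w⪯z) = Final.relabelled-achievable h′ inv finished′
              (trans (achievable-total h z∈) finished) (bal z∈)
        in ≤ᴿ-trans (ψ-mono w⪯z (Final.L⪯load h′ inv finished′)) (ψ≤φ h′ w∈))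
      (ends adversary) invariant-[])
    (bound adversary)
    where
    open Layers {n} {m} (load h) (trans (achievable-total h (load∈achievable h)) finished)

corollary1 : (n m : ℕ) (α : ℝ) → 0ᴿ <ᴿ α →
    (BL : DeterministicAllocation n) → IsBrickLaying BL →
    ((f : Vec ℕ n → ℝ) → NonNegative f → SchurConcave f → (A′ : Allocation n) →
    maxRegret n m f α (deterministic BL) ≤ᵁ maxRegret n m f α A′) ×
    ((g : Vec ℕ n → ℝ) → NonNegative g → SchurConvex g → (A′ : Allocation n) →
    minRegret n m g α (deterministic BL) ≤ᵁ minRegret n m g α A′)
corollary1 n m α 0<α BL isBL =
  (λ f _ concave → brickLaying-optimal
    (λ h → α *ᴿ maximum f (load∈achievable h) -ᴿ f (load h))
    (λ z ℓ → α *ᴿ f z -ᴿ f ℓ)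
    -- The cost grows when the alternative becomes more balanced and when the load becomes less
    -- balanced.
    (λ w⪯z ℓ⪯ℓ′ → +ᴿ-mono-≤ (*ᴿ-monoˡ-≤ (0≤α 0<α) (concave _ _ w⪯z)) (-ᴿ-anti-≤ (concave _ _ ℓ⪯ℓ′)))
    (λ h z∈ → +ᴿ-mono-≤
      (*ᴿ-monoˡ-≤ (0≤α 0<α) (proj₁ (maximum-isLub f (load∈achievable h)) (_ , z∈))) ≤ᴿ-refl)
    -- With `f (load h)` moved to the other side, the bound concerns `α *ᴿ f z` alone and passes to
    -- the maximum.
    (λ h ψ≤u → x≤z+y⇒x-y≤z (*ᴿ-maximum-≤ 0<α f (load∈achievable h) (λ z∈ → x-y≤z⇒x≤z+y (ψ≤u z∈))))
    BL isBL) ,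
  (λ g _ convex → brickLaying-optimal
    (λ h → g (load h) -ᴿ α *ᴿ minimum g (load∈achievable h))
    (λ z ℓ → g ℓ -ᴿ α *ᴿ g z)
    (λ w⪯z ℓ⪯ℓ′ → +ᴿ-mono-≤ (convex _ _ ℓ⪯ℓ′) (-ᴿ-anti-≤ (*ᴿ-monoˡ-≤ (0≤α 0<α) (convex _ _ w⪯z))))
    (λ h z∈ → +ᴿ-mono-≤ ≤ᴿ-refl
      (-ᴿ-anti-≤ (*ᴿ-monoˡ-≤ (0≤α 0<α) (proj₁ (minimum-isGlb g (load∈achievable h)) (_ , z∈)))))
    -- Swapping turns the bound into the lower bound `g (load h) -ᴿ u` of `α *ᴿ g z`, which passes
    -- to the minimum and is swapped back.
    (λ h ψ≤u → x-y≤z-swap (≤-*ᴿ-minimum 0<α g (load∈achievable h) (λ z∈ → x-y≤z-swap (ψ≤u z∈))))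
    BL isBL)
  where
  x-y≤z-swap : ∀ {x y z} → x -ᴿ y ≤ᴿ z → x -ᴿ z ≤ᴿ y
  x-y≤z-swap {x} {y} {z} le = x≤z+y⇒x-y≤z (≤ᴿ-trans (x-y≤z⇒x≤z+y le)
    (≗⇒≤ᴿ (z +ᴿ y) (y +ᴿ z) λ k → ℚ.+-comm (seq z k) (seq y k)))
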